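{- For every $n\ge1$, $\mathring{\mathfrak P}_n$ is a two-sided ideal of the peak algebra $\mathfrak P_n$. Moreover, for $n\ge 2$ there is an algebra isomorphism $\mathfrak P_n/\mathring{\mathfrak P}_n\cong\mathfrak P_{n-2}$.
   Context: Notation: $[m]=\{1,\dots,m\}$. $\mathcal S_n$ is the symmetric group, permutations written $w=w_1\cdots w_n$, product of $\mathbb Q\mathcal S_n$ is composition. The peak set of $w\in\mathcal S_n$ is $\mathrm{Peak}(w)=\{i\in[n-1]: w_{i-1}<w_i>w_{i+1}\}$ with convention $w_0=0$; the interior peak set is $\mathring{\mathrm{Peak}}(w)=\{i\in\{2,\dots,n-1\}: w_{i-1}<w_i>w_{i+1}\}$. $\mathcal F_n$ is the set of subsets of $[n-1]$ with no two consecutive integers, and $\mathring{\mathcal F}_n=\{F\in\mathcal F_n: 1\notin F\}$. For $F\in\mathcal F_n$, $P_F=\sum_{\mathrm{Peak}(w)=F}w$; for $F\in\mathring{\mathcal F}_n$, $\mathring P_F=\sum_{\mathring{\mathrm{Peak}}(w)=F}w$. The peak algebra $\mathfrak P_n$ is the span of $\{P_F\}_{F\in\mathcal F_n}$ (it is a subalgebra of $\mathbb Q\mathcal S_n$), and $\mathring{\mathfrak P}_n$ is the span of $\{\mathring P_F\}_{F\in\mathring{\mathcal F}_n}$. By convention $\mathfrak P_0=\mathbb Q$. -}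

module Defs where

open import Data.Bool using (Bool; true; false; _∧_; _∨_; not; if_then_else_; T)
open import Data.Nat using (ℕ; zero; suc; _∸_; _<ᵇ_; _≡ᵇ_)
open import Data.Fin using (Fin; toℕ)
open import Data.List using (List; []; _∷_; map; concatMap; _++_; upTo; foldr)
  renaming (allFin to allFinL)
open import Data.Vec using (Vec; []; _∷_; lookup; tabulate) renaming (toList to vtoList)
import Data.Vec.Properties as VecP
import Data.List.Properties as ListP
import Data.Fin as Fin
import Data.Nat as Nat
open import Data.Rational using (ℚ; 0ℚ; 1ℚ) renaming (_+_ to _+ℚ_; _*_ to _*ℚ_)
open import Data.Product using (Σ; _×_)
open import Relation.Nullary.Decidable using (⌊_⌋)
open import Relation.Binary.PropositionalEquality using (_≡_)

filterB : {A : Set} → (A → Bool) → List A → List A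
filterB p [] = []
filterB p (x ∷ xs) = if p x then x ∷ filterB p xs else filterB p xs

sumL : {A : Set} → List A → (A → ℚ) → ℚ
sumL xs f = foldr (λ a acc → f a +ℚ acc) 0ℚ xs

sublists : {A : Set} → List A → List (List A)
sublists [] = [] ∷ []
sublists (x ∷ xs) = map (x ∷_) (sublists xs) ++ sublists xs

-- The symmetric group S_n : permutations as words w = w_1 ... w_n,
-- letters in Fin n (Fin value k stands for the letter k+1).

Word : ℕ → Set
Word n = Vec (Fin n) n

words : (n m : ℕ) → List (Vec (Fin n) m)
words n zero = [] ∷ []
words n (suc m) = concatMap (λ v → map (_∷ v) (allFinL n)) (words n m)

distinct : {n : ℕ} → List (Fin n) → Bool
distinct [] = true
distinct (x ∷ xs) = not (anyEq x xs) ∧ distinct xs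
  where
  anyEq : _ → List _ → Bool
  anyEq x [] = false
  anyEq x (y ∷ ys) = ⌊ x Fin.≟ y ⌋ ∨ anyEq x ys

isPerm : {n : ℕ} → Word n → Bool
isPerm w = distinct (vtoList w)

perms : (n : ℕ) → List (Word n)
perms n = filterB isPerm (words n n)

_∘ₚ_ : {n : ℕ} → Word n → Word n → Word n
u ∘ₚ v = tabulate (λ i → lookup u (lookup v i))

_==ʷ_ : {n : ℕ} → Word n → Word n → Bool
u ==ʷ v = ⌊ VecP.≡-dec Fin._≟_ u v ⌋

-- The group algebra Q S_n : an element is its coefficient function.
-- Only the values on permutations matter (see _≈_).

QS : ℕ → Set
QS n = Word n → ℚ

_≈_ : {n : ℕ} → QS n → QS n → Set
_≈_ {n} x y = (w : Word n) → T (isPerm w) → x w ≡ y w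

0ₐ : {n : ℕ} → QS n
0ₐ w = 0ℚ

_+ₐ_ : {n : ℕ} → QS n → QS n → QS n
(x +ₐ y) w = x w +ℚ y w

_•_ : {n : ℕ} → ℚ → QS n → QS n
(c • x) w = c *ℚ x w

_*ₐ_ : {n : ℕ} → QS n → QS n → QS n
_*ₐ_ {n} x y w =
  sumL (perms n) (λ u → sumL (perms n) (λ v →
    if (u ∘ₚ v) ==ʷ w then x u *ℚ y v else 0ℚ))

-- Peaks. Positions are 1-based natural numbers; w_0 = 0.

range1 : ℕ → List ℕ
range1 n = map suc (upTo (n ∸ 1))

vals : {n : ℕ} → Word n → List ℕ
vals w = 0 ∷ map (λ k → suc (toℕ k)) (vtoList w)

at : List ℕ → ℕ → ℕ
at [] _ = 0
at (x ∷ xs) zero = x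
at (x ∷ xs) (suc i) = at xs i

isPeakAt : {n : ℕ} → Word n → ℕ → Bool
isPeakAt w i = (at (vals w) (i ∸ 1) <ᵇ at (vals w) i) ∧ (at (vals w) (suc i) <ᵇ at (vals w) i)

Peak : {n : ℕ} → Word n → List ℕ
Peak {n} w = filterB (isPeakAt w) (range1 n)

IPeak : {n : ℕ} → Word n → List ℕ
IPeak {n} w = filterB (λ i → (1 <ᵇ i) ∧ isPeakAt w i) (range1 n)

_==ˡ_ : List ℕ → List ℕ → Bool
F ==ˡ G = ⌊ ListP.≡-dec Nat._≟_ F G ⌋

-- no two consecutive integers (for increasing lists)
noConsec : List ℕ → Bool
noConsec [] = true
noConsec (x ∷ []) = true
noConsec (x ∷ y ∷ r) = not (suc x ≡ᵇ y) ∧ noConsec (y ∷ r)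

notHas1 : List ℕ → Bool
notHas1 [] = true
notHas1 (x ∷ r) = not (x ≡ᵇ 1) ∧ notHas1 r

𝓕 : ℕ → List (List ℕ)
𝓕 n = filterB noConsec (sublists (range1 n))

𝓕̊ : ℕ → List (List ℕ)
𝓕̊ n = filterB (λ F → noConsec F ∧ notHas1 F) (sublists (range1 n))

P : (n : ℕ) → List ℕ → QS n
P n F w = if isPerm w ∧ (Peak w ==ˡ F) then 1ℚ else 0ℚ

P̊ : (n : ℕ) → List ℕ → QS n
P̊ n F w = if isPerm w ∧ (IPeak w ==ˡ F) then 1ℚ else 0ℚ

lincomb : {n : ℕ} → List (List ℕ) → (List ℕ → ℚ) → (List ℕ → QS n) → QS n
lincomb Fs c B w = sumL Fs (λ F → c F *ℚ B F w)

In𝔓 : (n : ℕ) → QS n → Set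
In𝔓 n x = Σ (List ℕ → ℚ) (λ c → x ≈ lincomb (𝓕 n) c (P n))

In𝔓̊ : (n : ℕ) → QS n → Set
In𝔓̊ n x = Σ (List ℕ → ℚ) (λ c → x ≈ lincomb (𝓕̊ n) c (P̊ n))

IsTwoSidedIdealOf𝔓 : (n : ℕ) → Set
IsTwoSidedIdealOf𝔓 n =
  ((x : QS n) → In𝔓̊ n x → In𝔓 n x) ×
  ((x y : QS n) → In𝔓̊ n x → In𝔓 n y → In𝔓̊ n (x *ₐ y) × In𝔓̊ n (y *ₐ x))

-- An algebra isomorphism 𝔓_{m+2} / 𝔓̊_{m+2} ≅ 𝔓_m, given (quotients not
-- being available) as a map φ : 𝔓_{m+2} → 𝔓_m that respects ≈, is
-- Q-linear and multiplicative, whose kernel is exactly 𝔓̊_{m+2}, and which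
-- is onto 𝔓_m.  (First isomorphism theorem.)
record QuotientIso (m : ℕ) : Set where
  field
    φ        : QS (suc (suc m)) → QS m
    maps-to  : (x : QS (suc (suc m))) → In𝔓 (suc (suc m)) x → In𝔓 m (φ x)
    respects : (x y : QS (suc (suc m))) → In𝔓 (suc (suc m)) x → In𝔓 (suc (suc m)) y →
               x ≈ y → φ x ≈ φ y
    additive : (x y : QS (suc (suc m))) → In𝔓 (suc (suc m)) x → In𝔓 (suc (suc m)) y →
               φ (x +ₐ y) ≈ (φ x +ₐ φ y)
    homog    : (c : ℚ) (x : QS (suc (suc m))) → In𝔓 (suc (suc m)) x →
               φ (c • x) ≈ (c • φ x)
    multiplicative : (x y : QS (suc (suc m))) → In𝔓 (suc (suc m)) x → In𝔓 (suc (suc m)) y →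
               φ (x *ₐ y) ≈ (φ x *ₐ φ y)
    kernel   : (x : QS (suc (suc m))) → In𝔓 (suc (suc m)) x →
               (φ x ≈ 0ₐ → In𝔓̊ (suc (suc m)) x) × (In𝔓̊ (suc (suc m)) x → φ x ≈ 0ₐ)
    onto     : (y : QS m) → In𝔓 m y →
               Σ (QS (suc (suc m))) (λ x → In𝔓 (suc (suc m)) x × φ x ≈ y)

{-# OPTIONS --safe #-}
module Submission where

-- Let s_k exchange the letters k and k+1, so that w ↦ s_k w acts on words. Peak sets are
-- unchanged when k and k+1 are not adjacent in w, and when k = 1 unless 1 and 2 occupy the first
-- two positions; interior peak sets are unchanged by s_1 always. If w = u v and s_k u = u s_j
-- for some j, then s_k w = u (s_j v); otherwise s_k w = (s_k u) v with k, k+1 not adjacent in u.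
-- Hence the invariance properties pass to products, and a product of an element of 𝔓̊ with one of
-- 𝔓, in either order, has the invariance properties of 𝔓̊. They characterise 𝔓̊: they let one lower every word
-- lexicographically until its only inversions are at its interior peaks, and such a word is
-- determined by its interior peak set.
--
-- An element x of 𝔓 thus lies in 𝔓̊ iff x(12w) = x(21w) for all words w in the letters 3, …, n.
-- The isomorphism is induced by φ(x)(w) = x(12w) − x(21w). It is multiplicative because in
-- Σ_{uv=12w} (x(u) − x(s_1 u)) y(v) only those u survive in which 1 and 2 come first.

open import Defs
open import Data.Bool using (Bool; true; false; T; not; if_then_else_; _∧_)
open import Data.Bool.Properties using (T?; T-∧; T-≡)
open import Data.Empty using (⊥; ⊥-elim)
open import Data.Fin as Fin using (Fin; zero; suc; toℕ; fromℕ<; inject₁; punchOut)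
open import Data.Fin.Induction using () renaming (<-wellFounded to Fin-<-wellFounded)
open import Data.Fin.Permutation.Components using (transpose)
open import Data.Fin.Properties using (any?; suc-injective; toℕ-injective; toℕ<n; toℕ-fromℕ<; toℕ-inject₁; punchOut-injective; injective⇒≤; _<?_)
import Data.Fin.Properties as FinP
open import Data.List using (List; []; _∷_; map; _++_; filter; allFin; applyUpTo)
import Data.List.Properties as ListP
open import Data.List.Membership.Propositional using (_∈_)
open import Data.List.Membership.Propositional.Properties using (∈-map⁺; ∈-map⁻; ∈-++⁺ˡ; ∈-++⁺ʳ; ∈-++⁻; ∈-concat⁺′; ∈-filter⁺; ∈-filter⁻; ∈-allFin; ∈-upTo⁺; ∈-upTo⁻)
open import Data.List.Relation.Unary.All as All using (All; []; _∷_)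
import Data.List.Relation.Unary.All.Properties as AllP
open import Data.List.Relation.Unary.AllPairs as AllPairs using ([]; _∷_)
import Data.List.Relation.Unary.AllPairs.Properties as AllPairsP
open import Data.List.Relation.Unary.Any using (here; there)
open import Data.List.Relation.Unary.Unique.Propositional using (Unique)
import Data.List.Relation.Unary.Unique.Propositional.Properties as UniqueP
open import Data.Nat as ℕ using (ℕ; suc; _<ᵇ_; _∸_)
import Data.Nat.Properties as ℕP
open import Data.Product using (_×_; _,_; proj₁; proj₂; ∃; ∃₂)
open import Data.Rational using (ℚ; 0ℚ; 1ℚ; _+_; _*_; _-_; -_)
import Data.Rational.Properties as ℚP
open import Data.Rational.Solver using (module +-*-Solver)
open import Data.Sum using (_⊎_; inj₁; inj₂; [_,_]′)
open import Data.Vec as Vec using (Vec; []; _∷_; lookup; tabulate) renaming (toList to vtoList)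
import Data.Vec.Properties as VecP
import Data.Vec.Relation.Binary.Lex.Strict as Lex
open import Function using (_∘_; id; Equivalence)
open import Induction.WellFounded using (Acc; acc)
open import Relation.Binary.Definitions using (DecidableEquality; tri<; tri≈; tri>)
open import Relation.Binary.PropositionalEquality
open import Relation.Nullary using (Dec; yes; no; ¬_)
open import Relation.Nullary.Decidable using (⌊_⌋; _×-dec_; _⊎-dec_; ¬?; dec-true; dec-false; decidable-stable)

-- The delicate step is that the invariance properties suffice. Exchanging k and k+1 lowers a word
-- in which k+1 comes first, but it is allowed at once only if the two letters are not adjacent or k
-- = 1. If they are adjacent and no letter below k stands next to either, the exchange can still be
-- carried out: allowed exchanges lower the pair step by step to 1, 2 and back. In a word with no
-- lowering move left, each inverted pair k+1, k is therefore adjacent and has a neighbour below k.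
-- That neighbour cannot follow k: this would be a double descent, and each double descent forces
-- another one place further right, past the end of the word. So it precedes k+1, which is then an
-- interior peak. The shift by 2 in the quotient comes from peak sets. The prefix 12 has no peaks,
-- and its last letter acts before w like the convention w₀ = 0; 21w has one more peak, at 1. On
-- coefficients, φ thus sends c to F ↦ c(F+2) - c({1} ∪ (F+2)), and it is onto because the sets
-- containing 1 may be given coefficient 0.

private variable
  A B C : Set
  n m : ℕ
  i j k a b c d : Fin n

-- Permutation words as injective words.

-- The auxiliary membership test inside distinct cannot be named from outside. Its value on x and ys
-- is accessible only through distinct (x ∷ ys), conjoined with distinct ys; this works because Agda
-- ignores, when comparing its instances, the list from which the surrounding clause started.
distinct-repeat : ∀ {n} (x q : Fin n) ys → x ≢ q → distinct (x ∷ q ∷ q ∷ ys) ≡ false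
distinct-repeat x q ys x≢q with x Fin.≟ q | q Fin.≟ q
... | yes x≡q | _ = ⊥-elim (x≢q x≡q)
... | no _ | no q≢q = ⊥-elim (q≢q refl)
distinct-repeat x q [] x≢q | no _ | yes _ = refl
distinct-repeat x q (y ∷ ys) x≢q | no _ | yes _ with distinct-repeat x q ys x≢q
... | ih with x Fin.≟ y | x Fin.≟ q | q Fin.≟ q
...   | yes _ | _ | _ = refl
...   | no _ | yes x≡q | _ = ⊥-elim (x≢q x≡q)
...   | no _ | no _ | no q≢q = ⊥-elim (q≢q refl)
...   | no _ | no _ | yes _ = ih

-- If the tail were not distinct, the hypothesis would be stuck at `not _ ∧ false` with the
-- unnameable test inside. `distinct-repeat` yields this same expression and equates it with
-- `false`.
distinct-tail : ∀ {n} (x : Fin n) ys → T (distinct (x ∷ ys)) → T (distinct ys)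
distinct-tail x [] _ = _
distinct-tail x (y ∷ ys) t with distinct (y ∷ ys)
... | true = _
... | false with x Fin.≟ y | y Fin.≟ y | distinct-repeat x y ys
...   | no _ | no y≢y | _ = ⊥-elim (y≢y refl)
...   | no x≢y | yes _ | repeat = subst T (repeat x≢y) t

distinct-skip : ∀ {n} (x y : Fin n) ys → x ≢ y → T (distinct (y ∷ ys)) →
                distinct (x ∷ y ∷ ys) ≡ distinct (x ∷ ys)
distinct-skip x y ys x≢y t
  rewrite Equivalence.to T-≡ t | Equivalence.to T-≡ (distinct-tail y ys t) with x Fin.≟ y
... | yes x≡y = ⊥-elim (x≢y x≡y)
... | no _ = refl

distinct-∉ : ∀ {n} (x : Fin n) ys → T (distinct (x ∷ ys)) → All (x ≢_) ys
distinct-∉ x [] _ = []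
distinct-∉ x (y ∷ ys) t =
  x≢y t ∷ distinct-∉ x ys (subst T (distinct-skip x y ys (x≢y t) (distinct-tail x (y ∷ ys) t)) t)
  where
  x≢y : T (distinct (x ∷ y ∷ ys)) → x ≢ y
  x≢y t refl with x Fin.≟ x
  ... | no x≢x = x≢x refl

distinct-∷ : ∀ {n} (x : Fin n) ys → All (x ≢_) ys → T (distinct ys) → T (distinct (x ∷ ys))
distinct-∷ x [] _ _ = _
distinct-∷ x (y ∷ ys) (x≢y ∷ x∉) t =
  subst T (sym (distinct-skip x y ys x≢y t)) (distinct-∷ x ys x∉ (distinct-tail y ys t))

filterB≡filter : (p : A → Bool) (xs : List A) → filterB p xs ≡ filter (T? ∘ p) xs
filterB≡filter p [] = refl
filterB≡filter p (x ∷ xs) with p x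
... | true = cong (x ∷_) (filterB≡filter p xs)
... | false = filterB≡filter p xs

filterB-cong : {p q : A → Bool} (xs : List A) → (∀ {x} → x ∈ xs → p x ≡ q x) → filterB p xs ≡ filterB q xs
filterB-cong [] _ = refl
filterB-cong {p = p} {q} (x ∷ xs) p≗q rewrite p≗q (here refl) with q x
... | true = cong (x ∷_) (filterB-cong xs (p≗q ∘ there))
... | false = filterB-cong xs (p≗q ∘ there)

filterB-unique : (p : A → Bool) {xs : List A} → Unique xs → Unique (filterB p xs)
filterB-unique p {xs} rewrite filterB≡filter p xs = UniqueP.filter⁺ (T? ∘ p)

∈-filterB⁺ : (p : A → Bool) {x : A} {xs : List A} → x ∈ xs → T (p x) → x ∈ filterB p xs
∈-filterB⁺ p {xs = xs} rewrite filterB≡filter p xs = ∈-filter⁺ (T? ∘ p)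

∈-filterB⁻ : (p : A → Bool) {x : A} {xs : List A} → x ∈ filterB p xs → x ∈ xs × T (p x)
∈-filterB⁻ p {xs = xs} rewrite filterB≡filter p xs = ∈-filter⁻ (T? ∘ p)

All-toList⁺ : {P : A → Set} (v : Vec A n) → (∀ i → P (lookup v i)) → All P (vtoList v)
All-toList⁺ [] _ = []
All-toList⁺ (x ∷ v) p = p zero ∷ All-toList⁺ v (p ∘ suc)

All-toList⁻ : {P : A → Set} (v : Vec A n) → All P (vtoList v) → ∀ i → P (lookup v i)
All-toList⁻ (x ∷ v) (p ∷ _) zero = p
All-toList⁻ (x ∷ v) (_ ∷ ps) (suc i) = All-toList⁻ v ps i

Injective : Vec (Fin n) m → Set
Injective v = ∀ {i j} → lookup v i ≡ lookup v j → i ≡ j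

distinct⇒injective : (v : Vec (Fin n) m) → T (distinct (vtoList v)) → Injective v
distinct⇒injective (x ∷ v) d {zero} {zero} _ = refl
distinct⇒injective (x ∷ v) d {zero} {suc j} e = ⊥-elim (All-toList⁻ v (distinct-∉ x (vtoList v) d) j e)
distinct⇒injective (x ∷ v) d {suc i} {zero} e = ⊥-elim (All-toList⁻ v (distinct-∉ x (vtoList v) d) i (sym e))
distinct⇒injective (x ∷ v) d {suc i} {suc j} e =
  cong suc (distinct⇒injective v (distinct-tail x (vtoList v) d) e)

injective⇒distinct : (v : Vec (Fin n) m) → Injective v → T (distinct (vtoList v))
injective⇒distinct [] _ = _
injective⇒distinct (x ∷ v) inj =
  distinct-∷ x (vtoList v) (All-toList⁺ v λ i e → 0≢suc (inj {zero} {suc i} e))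
    (injective⇒distinct v (suc-injective ∘ inj))
  where
  0≢suc : {i : Fin m} → zero ≢ suc i
  0≢suc ()

words-complete : (v : Vec (Fin n) m) → v ∈ words n m
words-complete [] = here refl
words-complete {n} (x ∷ v) = ∈-concat⁺′ (∈-map⁺ (_∷ v) (∈-allFin x)) (∈-map⁺ (λ v → map (_∷ v) (allFin n)) (words-complete v))

words-unique : ∀ n m → Unique (words n m)
words-unique n ℕ.zero = [] ∷ []
words-unique n (ℕ.suc m) = UniqueP.concat⁺
  (AllP.map⁺ (All.universal (λ v → UniqueP.map⁺ VecP.∷-injectiveˡ (UniqueP.allFin⁺ n)) _))
  (AllPairsP.map⁺ (AllPairs.map disjoint (words-unique n m)))
  where
  disjoint : {v v′ : Vec (Fin n) m} → v ≢ v′ →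
             ∀ {w} → w ∈ map (_∷ v) (allFin n) × w ∈ map (_∷ v′) (allFin n) → _
  disjoint v≢v′ (p , q) with ∈-map⁻ _ p | ∈-map⁻ _ q
  ... | _ , _ , refl | _ , _ , e = v≢v′ (VecP.∷-injectiveʳ e)

perms-unique : ∀ n → Unique (perms n)
perms-unique n = filterB-unique isPerm (words-unique n n)

∈-perms⁺ : {w : Word n} → T (isPerm w) → w ∈ perms n
∈-perms⁺ {w = w} = ∈-filterB⁺ isPerm (words-complete w)

∈-perms⁻ : {w : Word n} → w ∈ perms n → T (isPerm w)
∈-perms⁻ {n} = proj₂ ∘ ∈-filterB⁻ isPerm {xs = words n n}

-- Finite rational sums and their reindexing.

sumL-cong : (xs : List A) {f g : A → ℚ} → (∀ {a} → a ∈ xs → f a ≡ g a) → sumL xs f ≡ sumL xs g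
sumL-cong [] _ = refl
sumL-cong (x ∷ xs) f≗g = cong₂ _+_ (f≗g (here refl)) (sumL-cong xs (f≗g ∘ there))

sumL-zero : (xs : List A) → sumL xs (λ _ → 0ℚ) ≡ 0ℚ
sumL-zero [] = refl
sumL-zero (x ∷ xs) = trans (ℚP.+-identityˡ _) (sumL-zero xs)

+-interchange : (a b c d : ℚ) → (a + b) + (c + d) ≡ (a + c) + (b + d)
+-interchange a b c d = begin
  (a + b) + (c + d) ≡⟨ ℚP.+-assoc a b (c + d) ⟩
  a + (b + (c + d)) ≡⟨ cong (a +_) (ℚP.+-assoc b c d) ⟨
  a + ((b + c) + d) ≡⟨ cong (λ z → a + (z + d)) (ℚP.+-comm b c) ⟩
  a + ((c + b) + d) ≡⟨ cong (a +_) (ℚP.+-assoc c b d) ⟩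
  a + (c + (b + d)) ≡⟨ ℚP.+-assoc a c (b + d) ⟨
  (a + c) + (b + d) ∎
  where open ≡-Reasoning

sumL-+ : (xs : List A) (f g : A → ℚ) → sumL xs (λ a → f a + g a) ≡ sumL xs f + sumL xs g
sumL-+ [] f g = refl
sumL-+ (x ∷ xs) f g = trans (cong (f x + g x +_) (sumL-+ xs f g)) (+-interchange (f x) (g x) _ _)

sumL-*ˡ : (xs : List A) (c : ℚ) (f : A → ℚ) → sumL xs (λ a → c * f a) ≡ c * sumL xs f
sumL-*ˡ [] c f = sym (ℚP.*-zeroʳ c)
sumL-*ˡ (x ∷ xs) c f = trans (cong (c * f x +_) (sumL-*ˡ xs c f)) (sym (ℚP.*-distribˡ-+ c (f x) _))

sumL-neg : (xs : List A) (f : A → ℚ) → sumL xs (λ a → - f a) ≡ - sumL xs f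
sumL-neg [] f = refl
sumL-neg (x ∷ xs) f = trans (cong (- f x +_) (sumL-neg xs f)) (sym (ℚP.neg-distrib-+ (f x) _))

sumL-minus : (xs : List A) (f g : A → ℚ) → sumL xs (λ a → f a - g a) ≡ sumL xs f - sumL xs g
sumL-minus xs f g = trans (sumL-+ xs f (-_ ∘ g)) (cong (sumL xs f +_) (sumL-neg xs g))

sumL-map : (h : A → B) (xs : List A) (f : B → ℚ) → sumL (map h xs) f ≡ sumL xs (f ∘ h)
sumL-map h [] f = refl
sumL-map h (x ∷ xs) f = cong (f (h x) +_) (sumL-map h xs f)

sumL-++ : (xs ys : List A) (f : A → ℚ) → sumL (xs ++ ys) f ≡ sumL xs f + sumL ys f
sumL-++ [] ys f = sym (ℚP.+-identityˡ _)
sumL-++ (x ∷ xs) ys f = trans (cong (f x +_) (sumL-++ xs ys f)) (sym (ℚP.+-assoc (f x) _ _))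

sumL-swap : (xs : List A) (ys : List B) (f : A → B → ℚ) →
            sumL xs (λ a → sumL ys (f a)) ≡ sumL ys (λ b → sumL xs (λ a → f a b))
sumL-swap [] ys f = sym (sumL-zero ys)
sumL-swap (x ∷ xs) ys f =
  trans (cong (sumL ys (f x) +_) (sumL-swap xs ys f)) (sym (sumL-+ ys (f x) _))

sumL-single : {xs : List A} {f : A → ℚ} {a : A} → Unique xs → a ∈ xs →
              (∀ {b} → b ∈ xs → b ≢ a → f b ≡ 0ℚ) → sumL xs f ≡ f a
sumL-single {xs = x ∷ xs} {f} (x∉ ∷ _) (here refl) f≡0 =
  trans (cong (f x +_) (trans (sumL-cong xs λ b∈ → f≡0 (there b∈) (All.lookup x∉ b∈ ∘ sym)) (sumL-zero xs)))
    (ℚP.+-identityʳ (f x))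
sumL-single {xs = x ∷ xs} (x∉ ∷ u) (there a∈) f≡0 =
  trans (cong₂ _+_ (f≡0 (here refl) (All.lookup x∉ a∈)) (sumL-single u a∈ (f≡0 ∘ there)))
    (ℚP.+-identityˡ _)

-- Both sums equal the sum of f over the graph of the partial bijection τ.
sumL-bijection :
  DecidableEquality A → DecidableEquality B → {xs : List A} {ys : List B} → Unique xs → Unique ys →
  (f : A → ℚ) (g : B → ℚ) (τ : A → B) (ρ : B → A) →
  (∀ {a} → a ∈ xs → f a ≡ 0ℚ ⊎ (τ a ∈ ys × ρ (τ a) ≡ a × g (τ a) ≡ f a)) →
  (∀ {b} → b ∈ ys → g b ≡ 0ℚ ⊎ (ρ b ∈ xs × τ (ρ b) ≡ b × f (ρ b) ≡ g b)) →
  sumL xs f ≡ sumL ys g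
sumL-bijection {A} {B} _≟_ _≟′_ {xs} {ys} ux uy f g τ ρ fwd bwd = begin
  sumL xs f                               ≡⟨ sumL-cong xs (sym ∘ row) ⟩
  sumL xs (λ a → sumL ys (onGraph a))           ≡⟨ sumL-swap xs ys onGraph ⟩
  sumL ys (λ b → sumL xs (λ a → onGraph a b))   ≡⟨ sumL-cong ys column ⟩
  sumL ys g                               ∎
  where
  open ≡-Reasoning
  graph? : ∀ a b → Dec (b ≡ τ a × a ≡ ρ b)
  graph? a b = (b ≟′ τ a) ×-dec (a ≟ ρ b)
  onGraph : A → B → ℚ
  onGraph a b = if ⌊ graph? a b ⌋ then f a else 0ℚ
  onGraph-≡ : ∀ {a b} → b ≡ τ a → a ≡ ρ b → onGraph a b ≡ f a
  onGraph-≡ {a} {b} p q with graph? a b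
  ... | yes _ = refl
  ... | no ¬r = ⊥-elim (¬r (p , q))
  onGraph-≢ : ∀ {a b} → (b ≡ τ a → a ≡ ρ b → f a ≡ 0ℚ) → onGraph a b ≡ 0ℚ
  onGraph-≢ {a} {b} h with graph? a b
  ... | yes (p , q) = h p q
  ... | no _ = refl
  row : ∀ {a} → a ∈ xs → sumL ys (onGraph a) ≡ f a
  row a∈ with fwd a∈
  ... | inj₁ fa≡0 = trans (trans (sumL-cong ys λ _ → onGraph-≢ λ _ _ → fa≡0) (sumL-zero ys)) (sym fa≡0)
  ... | inj₂ (τa∈ , ρτa≡a , _) =
    trans (sumL-single uy τa∈ λ _ b≢ → onGraph-≢ λ b≡ _ → ⊥-elim (b≢ b≡)) (onGraph-≡ refl (sym ρτa≡a))
  column : ∀ {b} → b ∈ ys → sumL xs (λ a → onGraph a b) ≡ g b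
  column {b} b∈ with bwd b∈
  ... | inj₁ gb≡0 = trans (trans (sumL-cong xs vanish) (sumL-zero xs)) (sym gb≡0)
    where
    vanish : ∀ {a} → a ∈ xs → onGraph a b ≡ 0ℚ
    vanish a∈ = onGraph-≢ λ b≡ _ → [ id ,
      (λ (_ , _ , gτa≡fa) → trans (sym gτa≡fa) (trans (cong g (sym b≡)) gb≡0)) ]′ (fwd a∈)
  ... | inj₂ (ρb∈ , τρb≡b , fρb≡gb) =
    trans (sumL-single ux ρb∈ λ _ a≢ → onGraph-≢ λ _ a≡ → ⊥-elim (a≢ a≡)) (trans (onGraph-≡ (sym τρb≡b) refl) fρb≡gb)

sumL-involution :
  DecidableEquality A → {xs : List A} → Unique xs → (f : A → ℚ) (τ : A → A) →
  (∀ {a} → a ∈ xs → τ a ∈ xs) → (∀ {a} → a ∈ xs → τ (τ a) ≡ a) →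
  sumL xs (f ∘ τ) ≡ sumL xs f
sumL-involution _≟_ u f τ τ∈ ττ = sumL-bijection _≟_ _≟_ u u (f ∘ τ) f τ τ
  (λ a∈ → inj₂ (τ∈ a∈ , ττ a∈ , refl)) (λ a∈ → inj₂ (τ∈ a∈ , ττ a∈ , cong f (ττ a∈)))

-- Transpositions acting on words and on products in the group algebra.

transpose-matchˡ : (a b : Fin n) → transpose a b a ≡ b
transpose-matchˡ a b rewrite dec-true (a Fin.≟ a) refl = refl

transpose-matchʳ : (a b : Fin n) → transpose a b b ≡ a
transpose-matchʳ a b with b Fin.≟ a
... | yes b≡a = b≡a
... | no _ rewrite dec-true (b Fin.≟ b) refl = refl

transpose-mismatch : (a b : Fin n) {k : Fin n} → k ≢ a → k ≢ b → transpose a b k ≡ k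
transpose-mismatch a b {k} k≢a k≢b
  rewrite dec-false (k Fin.≟ a) k≢a | dec-false (k Fin.≟ b) k≢b = refl

data Transposed (a b k : Fin n) : Fin n → Set where
  matchˡ   : k ≡ a → Transposed a b k b
  matchʳ   : k ≡ b → Transposed a b k a
  mismatch : k ≢ a → k ≢ b → Transposed a b k k

transposed : (a b k : Fin n) → Transposed a b k (transpose a b k)
transposed a b k with k Fin.≟ a
... | yes k≡a = matchˡ k≡a
... | no k≢a with k Fin.≟ b
...   | yes k≡b = matchʳ k≡b
...   | no k≢b = mismatch k≢a k≢b

transpose-involutive : (a b k : Fin n) → transpose a b (transpose a b k) ≡ k
transpose-involutive a b k with transpose a b k | transposed a b k
... | _ | matchˡ refl = transpose-matchʳ a b
... | _ | matchʳ refl = transpose-matchˡ a b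
... | _ | mismatch p q = transpose-mismatch a b p q

transpose-comm : (a b k : Fin n) → transpose a b k ≡ transpose b a k
transpose-comm a b k with transpose a b k | transposed a b k
... | _ | matchˡ refl = sym (transpose-matchʳ b a)
... | _ | matchʳ refl = sym (transpose-matchˡ b a)
... | _ | mismatch p q = sym (transpose-mismatch b a q p)

transpose-conjugate : {g : Fin m → Fin n} → (∀ {i j} → g i ≡ g j → i ≡ j) →
                      (i j k : Fin m) → transpose (g i) (g j) (g k) ≡ g (transpose i j k)
transpose-conjugate {g = g} inj i j k with transpose i j k | transposed i j k
... | _ | matchˡ refl = transpose-matchˡ (g i) (g j)
... | _ | matchʳ refl = transpose-matchʳ (g i) (g j)
... | _ | mismatch p q = transpose-mismatch (g i) (g j) (p ∘ inj) (q ∘ inj)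

lookup-ext : {u v : Vec C n} → (∀ i → lookup u i ≡ lookup v i) → u ≡ v
lookup-ext {u = u} {v} e =
  trans (sym (VecP.tabulate∘lookup u)) (trans (VecP.tabulate-cong e) (VecP.tabulate∘lookup v))

lookup-∘ₚ : (u v : Word n) (i : Fin n) → lookup (u ∘ₚ v) i ≡ lookup u (lookup v i)
lookup-∘ₚ u v = VecP.lookup∘tabulate _

∘ₚ-assoc : (u v w : Word n) → (u ∘ₚ v) ∘ₚ w ≡ u ∘ₚ (v ∘ₚ w)
∘ₚ-assoc u v w = VecP.tabulate-cong λ i →
  trans (lookup-∘ₚ u v (lookup w i)) (cong (lookup u) (sym (lookup-∘ₚ v w i)))

swapʷ : (a b : Fin n) → Word n
swapʷ a b = tabulate (transpose a b)

lookup-swapʷ : (a b : Fin n) (u : Word n) (i : Fin n) →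
               lookup (swapʷ a b ∘ₚ u) i ≡ transpose a b (lookup u i)
lookup-swapʷ a b u i = trans (lookup-∘ₚ (swapʷ a b) u i) (VecP.lookup∘tabulate _ (lookup u i))

swapʷ-involutive : (a b : Fin n) (u : Word n) → swapʷ a b ∘ₚ (swapʷ a b ∘ₚ u) ≡ u
swapʷ-involutive a b u = lookup-ext λ i → begin
  lookup (swapʷ a b ∘ₚ (swapʷ a b ∘ₚ u)) i       ≡⟨ lookup-swapʷ a b (swapʷ a b ∘ₚ u) i ⟩
  transpose a b (lookup (swapʷ a b ∘ₚ u) i)      ≡⟨ cong (transpose a b) (lookup-swapʷ a b u i) ⟩
  transpose a b (transpose a b (lookup u i))     ≡⟨ transpose-involutive a b (lookup u i) ⟩
  lookup u i                                     ∎
  where open ≡-Reasoning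

swapʷ-cancel : (a b : Fin n) {u v : Word n} → swapʷ a b ∘ₚ u ≡ swapʷ a b ∘ₚ v → u ≡ v
swapʷ-cancel a b {u} {v} e =
  trans (sym (swapʷ-involutive a b u)) (trans (cong (swapʷ a b ∘ₚ_) e) (swapʷ-involutive a b v))

isPerm-injective : {u : Word n} → T (isPerm u) → Injective u
isPerm-injective {u = u} = distinct⇒injective u

isPerm-swapʷ : (a b : Fin n) {u : Word n} → T (isPerm u) → T (isPerm (swapʷ a b ∘ₚ u))
isPerm-swapʷ a b {u} pu = injective⇒distinct (swapʷ a b ∘ₚ u) λ {i} {j} e →
  isPerm-injective {u = u} pu (begin
    lookup u i                                 ≡⟨ transpose-involutive a b (lookup u i) ⟨
    transpose a b (transpose a b (lookup u i))
      ≡⟨ cong (transpose a b) (trans (sym (lookup-swapʷ a b u i)) (trans e (lookup-swapʷ a b u j))) ⟩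
    transpose a b (transpose a b (lookup u j)) ≡⟨ transpose-involutive a b (lookup u j) ⟩
    lookup u j                                 ∎)
  where open ≡-Reasoning

infix 4 _≟ʷ_

_≟ʷ_ : (u v : Word n) → Dec (u ≡ v)
_≟ʷ_ = VecP.≡-dec Fin._≟_

-- Compares terms of two products. The coefficients may be compared under the condition `Q`, and
-- this is how an equation u v = w reaches the invariance hypotheses on the second factor.
if-⇔ : {P Q : Set} (P? : Dec P) (Q? : Dec Q) {c d : ℚ} → (P → Q) → (Q → P) → (Q → c ≡ d) →
       (if ⌊ P? ⌋ then c else 0ℚ) ≡ (if ⌊ Q? ⌋ then d else 0ℚ)
if-⇔ (yes p) (yes q) _ _ e = e q
if-⇔ (no _) (no _) _ _ _ = refl
if-⇔ (yes p) (no ¬q) f _ _ = ⊥-elim (¬q (f p))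
if-⇔ (no ¬p) (yes q) _ g _ = ⊥-elim (¬p (g q))

sumL-swapʷ : (a b : Fin n) (f : Word n → ℚ) →
             sumL (perms n) (f ∘ (swapʷ a b ∘ₚ_)) ≡ sumL (perms n) f
sumL-swapʷ {n} a b f = sumL-involution _≟ʷ_ (perms-unique n) f (swapʷ a b ∘ₚ_)
  (λ {u} u∈ → ∈-perms⁺ (isPerm-swapʷ a b {u} (∈-perms⁻ u∈))) (λ {u} _ → swapʷ-involutive a b u)

-- The factorisations u v of w are matched with those of s w by (u , v) ↦ (u , t v)
-- if s u = u t with A u, and by (u , v) ↦ (s u , v) otherwise.
product-swapʷ :
  (a b : Fin n) (x y : QS n) (w : Word n) {A : Word n → Set} (A? : ∀ u → Dec (A u)) →
  (∀ {u} → A u → A (swapʷ a b ∘ₚ u)) →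
  (∀ {u} → T (isPerm u) → ¬ A u → x (swapʷ a b ∘ₚ u) ≡ x u) →
  (∀ {u} → T (isPerm u) → A u → ∃₂ λ c d → swapʷ a b ∘ₚ u ≡ u ∘ₚ swapʷ c d ×
    (∀ {v} → T (isPerm v) → u ∘ₚ v ≡ w → y (swapʷ c d ∘ₚ v) ≡ y v)) →
  (x *ₐ y) (swapʷ a b ∘ₚ w) ≡ (x *ₐ y) w
product-swapʷ {n} a b x y w {A} A? A-closed x-inv y-inv = begin
  sumL (perms n) F        ≡⟨ sumL-involution _≟ʷ_ (perms-unique n) F σ σ∈ (λ {u} _ → σσ u) ⟨
  sumL (perms n) (F ∘ σ)  ≡⟨ sumL-cong (perms n) Fσ≡G ⟩
  sumL (perms n) G        ∎
  where
  open ≡-Reasoning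
  s = swapʷ a b
  F G : Word n → ℚ
  F u = sumL (perms n) λ v → if (u ∘ₚ v) ==ʷ (s ∘ₚ w) then x u * y v else 0ℚ
  G u = sumL (perms n) λ v → if (u ∘ₚ v) ==ʷ w then x u * y v else 0ℚ
  σ : Word n → Word n
  σ u = if ⌊ A? u ⌋ then u else s ∘ₚ u
  σ∈ : ∀ {u} → u ∈ perms n → σ u ∈ perms n
  σ∈ {u} u∈ with A? u
  ... | yes _ = u∈
  ... | no _ = ∈-perms⁺ (isPerm-swapʷ a b {u} (∈-perms⁻ u∈))
  σσ : ∀ u → σ (σ u) ≡ u
  σσ u with A? u
  ... | yes au with A? u
  ...   | yes _ = refl
  ...   | no ¬au = ⊥-elim (¬au au)
  σσ u | no ¬au with A? (s ∘ₚ u)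
  ...   | no _ = swapʷ-involutive a b u
  -- `A-closed` applied to `s ∘ₚ u` would give `A u` back, so `σ` never crosses between its two
  -- cases.
  ...   | yes asu = ⊥-elim (¬au (subst A (swapʷ-involutive a b u) (A-closed asu)))
  Fσ≡G : ∀ {u} → u ∈ perms n → F (σ u) ≡ G u
  Fσ≡G {u} u∈ with A? u
  ... | no ¬au = sumL-cong (perms n) λ {v} _ →
    if-⇔ ((s ∘ₚ u) ∘ₚ v ≟ʷ (s ∘ₚ w)) (u ∘ₚ v ≟ʷ w)
      (λ e → swapʷ-cancel a b (trans (sym (∘ₚ-assoc s u v)) e))
      (λ e → trans (∘ₚ-assoc s u v) (cong (s ∘ₚ_) e))
      (λ _ → cong (_* y v) (x-inv (∈-perms⁻ u∈) ¬au))
  ... | yes au with y-inv (∈-perms⁻ u∈) au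
  ...   | c , d , su≡ut , y-inv′ =
    trans (sym (sumL-swapʷ c d λ v → if (u ∘ₚ v) ==ʷ (s ∘ₚ w) then x u * y v else 0ℚ))
      (sumL-cong (perms n) λ {v} v∈ →
        if-⇔ (u ∘ₚ (swapʷ c d ∘ₚ v) ≟ʷ (s ∘ₚ w)) (u ∘ₚ v ≟ʷ w)
          (λ e → swapʷ-cancel a b (trans (sym (slide v)) e))
          (λ e → trans (slide v) (cong (s ∘ₚ_) e))
          (λ e → cong (x u *_) (y-inv′ (∈-perms⁻ v∈) e)))
    where
    slide : ∀ v → u ∘ₚ (swapʷ c d ∘ₚ v) ≡ s ∘ₚ (u ∘ₚ v)
    slide v = begin
      u ∘ₚ (swapʷ c d ∘ₚ v) ≡⟨ ∘ₚ-assoc u (swapʷ c d) v ⟨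
      (u ∘ₚ swapʷ c d) ∘ₚ v ≡⟨ cong (_∘ₚ v) su≡ut ⟨
      (s ∘ₚ u) ∘ₚ v         ≡⟨ ∘ₚ-assoc s u v ⟩
      s ∘ₚ (u ∘ₚ v)         ∎

-- Invariance under exchanging consecutive letters, and its passage to products.

Next : Fin n → Fin n → Set
Next i j = toℕ j ≡ ℕ.suc (toℕ i)

Adj : (a b : Fin n) → Word n → Set
Adj a b u = ∃₂ λ i j → Next i j ×
  ((lookup u i ≡ a × lookup u j ≡ b) ⊎ (lookup u i ≡ b × lookup u j ≡ a))

Adj? : (a b : Fin n) (u : Word n) → Dec (Adj a b u)
Adj? a b u = any? λ i → any? λ j → (toℕ j ℕ.≟ ℕ.suc (toℕ i)) ×-dec
  (((lookup u i Fin.≟ a) ×-dec (lookup u j Fin.≟ b)) ⊎-dec ((lookup u i Fin.≟ b) ×-dec (lookup u j Fin.≟ a)))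

-- The set {a, b} is preserved, not necessarily pointwise, so u commutes with the transposition of a
-- and b. For the two smallest letters this says that they occupy the first two positions.
Fixes : (a b : Fin n) → Word n → Set
Fixes a b u = (lookup u a ≡ a × lookup u b ≡ b) ⊎ (lookup u a ≡ b × lookup u b ≡ a)

Fixes? : (a b : Fin n) (u : Word n) → Dec (Fixes a b u)
Fixes? a b u = ((lookup u a Fin.≟ a) ×-dec (lookup u b Fin.≟ b)) ⊎-dec ((lookup u a Fin.≟ b) ×-dec (lookup u b Fin.≟ a))

-- The codomain is arbitrary so that the notion covers elements of the group algebra, the maps
-- `Peak` and `IPeak`, and pairs of such functions.
AdjInvariant : (Word n → C) → Set
AdjInvariant {n} f = ∀ {a b} → Next a b → ∀ {u} → T (isPerm u) → ¬ Adj a b u → f (swapʷ a b ∘ₚ u) ≡ f u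

-- The letters 1 and 2 are given by their values, since `Fin n` need not contain them for a general
-- n.
BaseInvariant : (Word n → C) → Set
BaseInvariant {n} f = ∀ {a b} → toℕ a ≡ 0 → toℕ b ≡ 1 → ∀ {u} → T (isPerm u) → f (swapʷ a b ∘ₚ u) ≡ f u

BaseInvariantOffFixes : (Word n → C) → Set
BaseInvariantOffFixes {n} f = ∀ {a b} → toℕ a ≡ 0 → toℕ b ≡ 1 →
  ∀ {u} → T (isPerm u) → ¬ Fixes a b u → f (swapʷ a b ∘ₚ u) ≡ f u

lookup-swapʷ-at : (a b : Fin n) (u : Word n) {i : Fin n} {c : Fin n} → lookup u i ≡ c →
                  lookup (swapʷ a b ∘ₚ u) i ≡ transpose a b c
lookup-swapʷ-at a b u {i} e = trans (lookup-swapʷ a b u i) (cong (transpose a b) e)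

swapʷ-pair : (a b : Fin n) (u : Word n) {i j : Fin n} →
  (lookup u i ≡ a × lookup u j ≡ b) ⊎ (lookup u i ≡ b × lookup u j ≡ a) →
  let u′ = swapʷ a b ∘ₚ u in
  (lookup u′ i ≡ a × lookup u′ j ≡ b) ⊎ (lookup u′ i ≡ b × lookup u′ j ≡ a)
swapʷ-pair a b u (inj₁ (p , q)) =
  inj₂ (trans (lookup-swapʷ-at a b u p) (transpose-matchˡ a b) , trans (lookup-swapʷ-at a b u q) (transpose-matchʳ a b))
swapʷ-pair a b u (inj₂ (p , q)) =
  inj₁ (trans (lookup-swapʷ-at a b u p) (transpose-matchʳ a b) , trans (lookup-swapʷ-at a b u q) (transpose-matchˡ a b))

Adj-swapʷ : (a b : Fin n) {u : Word n} → Adj a b u → Adj a b (swapʷ a b ∘ₚ u)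
Adj-swapʷ a b {u} (i , j , i→j , h) = i , j , i→j , swapʷ-pair a b u h

swapʷ-slide : (a b i j : Fin n) {u : Word n} → T (isPerm u) →
  (lookup u i ≡ a × lookup u j ≡ b) ⊎ (lookup u i ≡ b × lookup u j ≡ a) →
  swapʷ a b ∘ₚ u ≡ u ∘ₚ swapʷ i j
swapʷ-slide a b i j {u} pu h = lookup-ext λ k → begin
  lookup (swapʷ a b ∘ₚ u) k                             ≡⟨ lookup-swapʷ a b u k ⟩
  transpose a b (lookup u k)                            ≡⟨ values h k ⟩
  transpose (lookup u i) (lookup u j) (lookup u k)      ≡⟨ transpose-conjugate {g = lookup u} (isPerm-injective {u = u} pu) i j k ⟩
  lookup u (transpose i j k)                            ≡⟨ cong (lookup u) (VecP.lookup∘tabulate (transpose i j) k) ⟨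
  lookup u (lookup (swapʷ i j) k)                       ≡⟨ lookup-∘ₚ u (swapʷ i j) k ⟨
  lookup (u ∘ₚ swapʷ i j) k                             ∎
  where
  open ≡-Reasoning
  values : (lookup u i ≡ a × lookup u j ≡ b) ⊎ (lookup u i ≡ b × lookup u j ≡ a) →
           ∀ k → transpose a b (lookup u k) ≡ transpose (lookup u i) (lookup u j) (lookup u k)
  values (inj₁ (refl , refl)) k = refl
  values (inj₂ (refl , refl)) k = transpose-comm _ _ (lookup u k)

compose-pair : (u v : Word n) {a b c d i j : Fin n} →
  (lookup u c ≡ a × lookup u d ≡ b) ⊎ (lookup u c ≡ b × lookup u d ≡ a) →
  (lookup v i ≡ c × lookup v j ≡ d) ⊎ (lookup v i ≡ d × lookup v j ≡ c) →
  (lookup (u ∘ₚ v) i ≡ a × lookup (u ∘ₚ v) j ≡ b) ⊎ (lookup (u ∘ₚ v) i ≡ b × lookup (u ∘ₚ v) j ≡ a)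
compose-pair u v (inj₁ (refl , refl)) (inj₁ (refl , refl)) = inj₁ (lookup-∘ₚ u v _ , lookup-∘ₚ u v _)
compose-pair u v (inj₁ (refl , refl)) (inj₂ (refl , refl)) = inj₂ (lookup-∘ₚ u v _ , lookup-∘ₚ u v _)
compose-pair u v (inj₂ (refl , refl)) (inj₁ (refl , refl)) = inj₂ (lookup-∘ₚ u v _ , lookup-∘ₚ u v _)
compose-pair u v (inj₂ (refl , refl)) (inj₂ (refl , refl)) = inj₁ (lookup-∘ₚ u v _ , lookup-∘ₚ u v _)

-- If u has a, b at neighbouring positions i, j, then s u = u t with t exchanging the consecutive
-- letters i, j of v. Were these adjacent in v, then a and b would be adjacent in u v = w; so the
-- invariance of `y` applies. For all other u the left factor absorbs s.
*ₐ-adjInvariant : {x y : QS n} → AdjInvariant x → AdjInvariant y → AdjInvariant (x *ₐ y)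
*ₐ-adjInvariant {x = x} {y} x-inv y-inv {a} {b} a→b {w} _ ¬adj =
  product-swapʷ a b x y w (Adj? a b) (λ {u} → Adj-swapʷ a b {u}) (λ {u} pu → x-inv a→b {u} pu)
    λ {u} pu (i , j , i→j , h) → i , j , swapʷ-slide a b i j {u} pu h ,
      λ {v} pv uv≡w → y-inv i→j {v} pv λ (k , l , k→l , g) →
        ¬adj (subst (Adj a b) uv≡w (k , l , k→l , compose-pair u v h g))

-- The left factor always absorbs s, so the predicate that sends s to the right is empty.
*ₐ-baseInvariantˡ : {x y : QS n} → BaseInvariant x → BaseInvariant (x *ₐ y)
*ₐ-baseInvariantˡ {x = x} {y} x-inv {a} {b} a≡0 b≡1 {w} _ =
  product-swapʷ a b x y w {A = λ _ → ⊥} (λ _ → no id) id (λ {u} pu _ → x-inv a≡0 b≡1 {u} pu) (λ _ ())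

-- The left factor absorbs s unless u preserves {1, 2}; in that case s commutes with u and is
-- absorbed by `x` on the right.
*ₐ-baseInvariantʳ : {x y : QS n} → BaseInvariantOffFixes y → BaseInvariant x → BaseInvariant (y *ₐ x)
*ₐ-baseInvariantʳ {x = x} {y} y-inv x-inv {a} {b} a≡0 b≡1 {w} _ =
  product-swapʷ a b y x w (Fixes? a b) (λ {u} → swapʷ-pair a b u) (λ {u} pu → y-inv a≡0 b≡1 {u} pu)
    λ {u} pu h → a , b , swapʷ-slide a b a b {u} pu h , λ {v} pv _ → x-inv a≡0 b≡1 {v} pv

-- Lowering words: exchanges in valleys and lexicographic normal forms.

Next⇒< : Next i j → i Fin.< j
Next⇒< e = ℕP.≤-reflexive (sym e)

Next-functional : Next i j → Next i k → j ≡ k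
Next-functional p q = toℕ-injective (trans p (sym q))

Next-injective : Next i k → Next j k → i ≡ j
Next-injective p q = toℕ-injective (ℕP.suc-injective (trans (sym p) q))

predecessor : (i : Fin n) → toℕ i ≡ 0 ⊎ ∃ λ h → Next h i
predecessor zero = inj₁ refl
predecessor (suc i) = inj₂ (inject₁ i , cong ℕ.suc (sym (toℕ-inject₁ i)))

successor : {i j : Fin n} → i Fin.< j → ∃ λ k → Next i k
successor {i = i} {j = j} i<j = fromℕ< 1+i<n , toℕ-fromℕ< 1+i<n
  where 1+i<n = ℕP.≤-<-trans i<j (toℕ<n j)

-- Pigeonhole: if c were missed, `punchOut` would turn u into an injection into a set with one
-- element fewer.
position : (u : Word n) → T (isPerm u) → ∀ c → ∃ λ i → lookup u i ≡ c
position {n = ℕ.suc n} u pu c with any? (λ i → lookup u i Fin.≟ c)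
... | yes p = p
... | no ¬p = ⊥-elim (ℕP.n≮n n (injective⇒≤ {f = λ i → punchOut (c≢ i)}
    (isPerm-injective {u = u} pu ∘ punchOut-injective (c≢ _) (c≢ _))))
  where
  c≢ : ∀ i → c ≢ lookup u i
  c≢ i e = ¬p (i , sym e)

Adj-pull : {u : Word n} → transpose a b c ≡ i → transpose a b d ≡ j → Adj c d (swapʷ a b ∘ₚ u) → Adj i j u
Adj-pull {a = a} {b} {u = u} refl refl (x , y , x→y , h) = x , y , x→y ,
  [ (λ (p , q) → inj₁ (pull p , pull q)) , (λ (p , q) → inj₂ (pull p , pull q)) ]′ h
  where
  pull : ∀ {x c} → lookup (swapʷ a b ∘ₚ u) x ≡ c → lookup u x ≡ transpose a b c
  pull {x} e = trans (sym (transpose-involutive a b (lookup u x))) (cong (transpose a b) (trans (sym (lookup-swapʷ a b u x)) e))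

Adj-sym : {u : Word n} → Adj a b u → Adj b a u
Adj-sym (x , y , x→y , h) = x , y , x→y , [ inj₂ , inj₁ ]′ h

-- (c a) (a b) (c a) (a b) (c a) = (a b)
braid : c ≢ a → a ≢ b → c ≢ b → (u : Word n) →
  swapʷ c a ∘ₚ (swapʷ a b ∘ₚ (swapʷ c a ∘ₚ (swapʷ a b ∘ₚ (swapʷ c a ∘ₚ u)))) ≡ swapʷ a b ∘ₚ u
braid {c = c} {a = a} {b = b} c≢a a≢b c≢b u = lookup-ext λ i → begin
  lookup (s ∘ₚ (t ∘ₚ (s ∘ₚ (t ∘ₚ (s ∘ₚ u))))) i
    ≡⟨ push c a (t ∘ₚ (s ∘ₚ (t ∘ₚ (s ∘ₚ u))))
       (push a b (s ∘ₚ (t ∘ₚ (s ∘ₚ u))) (push c a (t ∘ₚ (s ∘ₚ u)) (push a b (s ∘ₚ u) (lookup-swapʷ c a u i)))) ⟩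
  σ (τ (σ (τ (σ (lookup u i)))))              ≡⟨ cong (σ ∘ τ) (conj c a a b (lookup u i)) ⟩
  σ (τ (transpose (σ a) (σ b) (lookup u i)))
    ≡⟨ cong₂ (λ x y → σ (τ (transpose x y (lookup u i))))
       (transpose-matchʳ c a) (transpose-mismatch c a (c≢b ∘ sym) (a≢b ∘ sym)) ⟩
  σ (τ (transpose c b (lookup u i)))          ≡⟨ cong σ (transpose-conjugate {g = τ} (inj a b) c b (lookup u i)) ⟨
  σ (transpose (τ c) (τ b) (τ (lookup u i)))
    ≡⟨ cong₂ (λ x y → σ (transpose x y (τ (lookup u i))))
       (transpose-mismatch a b c≢a c≢b) (transpose-matchʳ a b) ⟩
  σ (σ (τ (lookup u i)))                      ≡⟨ transpose-involutive c a _ ⟩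
  τ (lookup u i)                              ≡⟨ lookup-swapʷ a b u i ⟨
  lookup (t ∘ₚ u) i                           ∎
  where
  open ≡-Reasoning
  s = swapʷ c a
  t = swapʷ a b
  σ = transpose c a
  τ = transpose a b
  push : ∀ a b w {i c} → lookup w i ≡ c → lookup (swapʷ a b ∘ₚ w) i ≡ transpose a b c
  push a b w = lookup-swapʷ-at a b w
  inj : ∀ a b {i j} → transpose a b i ≡ transpose a b j → i ≡ j
  inj a b {i} {j} e = trans (sym (transpose-involutive a b i)) (trans (cong (transpose a b) e) (transpose-involutive a b j))
  conj : ∀ a b c d k → transpose a b (transpose c d (transpose a b k)) ≡ transpose (transpose a b c) (transpose a b d) k
  conj a b c d k = trans (sym (transpose-conjugate {g = transpose a b} (inj a b) c d (transpose a b k)))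
    (cong (transpose (transpose a b c) (transpose a b d)) (transpose-involutive a b k))

Touches : (a b : Fin n) → Word n → Set
Touches a b u = ∃ λ c → c Fin.< a × (Adj c a u ⊎ Adj c b u)

Touches? : (a b : Fin n) (u : Word n) → Dec (Touches a b u)
Touches? a b u = any? λ c → (c <? a) ×-dec (Adj? c a u ⊎-dec Adj? c b u)

-- If the letters a, b form the bottom of a valley, the letter c preceding a is adjacent to neither,
-- so a, b can be lowered to c, a by swaps of non-adjacent letters; this is undone after the swap.
swap-untouched : {f : Word n → C} → AdjInvariant f → BaseInvariant f → ∀ k {a b} → toℕ a ≡ k → Next a b →
                 (u : Word n) → T (isPerm u) → ¬ Touches a b u → f (swapʷ a b ∘ₚ u) ≡ f u
swap-untouched adj base ℕ.zero a≡0 a→b u pu _ = base a≡0 (trans a→b (cong ℕ.suc a≡0)) {u} pu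
swap-untouched {f = f} adj base (ℕ.suc k) {a} {b} a≡k a→b u pu ¬t with predecessor a
... | inj₁ a≡0 with () ← trans (sym a≡0) a≡k
... | inj₂ (c , c→a) = begin
  f (t ∘ₚ u)                                     ≡⟨ cong f (braid c≢a a≢b c≢b u) ⟨
  -- Each of the four outer exchanges involves letters standing at the original places of c and of
  -- one of a, b. Pulled back to u, an adjacency would be one of c with a or b, which `¬t` excludes.
  f (s ∘ₚ u₄)                                    ≡⟨ adj c→a {u₄} p₄
       (λ h → ¬t (c , Next⇒< c→a , inj₂
         (Adj-sym {u = u} (Adj-pull {u = u} σb σa (Adj-pull {u = u₁} τa τb (Adj-pull {u = u₂} σc σb (Adj-pull {u = u₃} τc τa h))))))) ⟩
  f (t ∘ₚ u₃)                                    ≡⟨ adj a→b {u₃} p₃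
       (λ h → ¬t (c , Next⇒< c→a , inj₁
         (Adj-sym {u = u} (Adj-pull {u = u} σc σa (Adj-pull {u = u₁} τc τb (Adj-pull {u = u₂} σa σb h)))))) ⟩
  -- In `u₂` the original places of a and b hold c and a, so this is the same exchange one letter
  -- lower. Letters below c have not moved, hence none of them touches the pair.
  f (s ∘ₚ u₂)
    ≡⟨ swap-untouched adj base k (ℕP.suc-injective (trans (sym c→a) a≡k)) c→a u₂ p₂ untouched ⟩
  f (t ∘ₚ u₁)                                    ≡⟨ adj a→b {u₁} p₁ (λ h → ¬t (c , Next⇒< c→a , inj₂ (Adj-pull {u = u} σa σb h))) ⟩
  f (s ∘ₚ u)                                     ≡⟨ adj c→a {u} pu (λ h → ¬t (c , Next⇒< c→a , inj₁ h)) ⟩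
  f u                                            ∎
  where
  open ≡-Reasoning
  s = swapʷ c a
  t = swapʷ a b
  u₁ = s ∘ₚ u
  u₂ = t ∘ₚ u₁
  u₃ = s ∘ₚ u₂
  u₄ = t ∘ₚ u₃
  p₁ = isPerm-swapʷ c a {u} pu
  p₂ = isPerm-swapʷ a b {u₁} p₁
  p₃ = isPerm-swapʷ c a {u₂} p₂
  p₄ = isPerm-swapʷ a b {u₃} p₃
  c≢a = FinP.<⇒≢ (Next⇒< {i = c} c→a)
  a≢b = FinP.<⇒≢ (Next⇒< {i = a} a→b)
  c≢b = FinP.<⇒≢ (FinP.<-trans {i = c} (Next⇒< {i = c} c→a) (Next⇒< {i = a} a→b))
  σc = transpose-matchˡ c a
  σa = transpose-matchʳ c a
  σb = transpose-mismatch c a (c≢b ∘ sym) (a≢b ∘ sym)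
  τa = transpose-matchˡ a b
  τb = transpose-matchʳ a b
  τc = transpose-mismatch a b c≢a c≢b
  untouched : ¬ Touches c a u₂
  untouched (d , d<c , h) = ¬t (d , d<a ,
    [ (λ h → inj₁ (Adj-pull {u = u} σd σc (Adj-pull {u = u₁} τd τc h))) ,
      (λ h → inj₂ (Adj-pull {u = u} σd σb (Adj-pull {u = u₁} τd τa h))) ]′ h)
    where
    d<a = FinP.<-trans {i = d} d<c (Next⇒< {i = c} c→a)
    d≢c = FinP.<⇒≢ d<c
    d≢a = FinP.<⇒≢ d<a
    d≢b = FinP.<⇒≢ (FinP.<-trans {i = d} d<a (Next⇒< {i = a} a→b))
    σd = transpose-mismatch c a d≢c d≢a
    τd = transpose-mismatch a b d≢a d≢b

_<ₗ_ : Vec (Fin n) m → Vec (Fin n) m → Set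
_<ₗ_ = Lex.Lex-< _≡_ Fin._<_

transpose-<ₗ : Next a b → (v : Vec (Fin n) m) (i : Fin m) → lookup v i ≡ b →
               (∀ k → k Fin.< i → lookup v k ≢ a × lookup v k ≢ b) → Vec.map (transpose a b) v <ₗ v
transpose-<ₗ {a = a} {b = b} a→b (x ∷ v) zero refl _ =
  Lex.this (subst (Fin._< b) (sym (transpose-matchʳ a b)) (Next⇒< a→b)) refl
transpose-<ₗ {a = a} {b = b} a→b (x ∷ v) (suc i) e before =
  Lex.next (transpose-mismatch a b (proj₁ (before zero (ℕ.s≤s ℕ.z≤n))) (proj₂ (before zero (ℕ.s≤s ℕ.z≤n))))
    (transpose-<ₗ a→b v i e λ k k<i → before (suc k) (ℕ.s≤s k<i))

Inverted : (a b : Fin n) → Word n → Set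
Inverted a b u = ∃₂ λ i j → i Fin.< j × lookup u i ≡ b × lookup u j ≡ a

swapʷ-<ₗ : Next a b → (u : Word n) → T (isPerm u) → Inverted a b u → (swapʷ a b ∘ₚ u) <ₗ u
swapʷ-<ₗ {a = a} {b = b} a→b u pu (i , j , i<j , ui≡b , uj≡a) =
  subst (_<ₗ u) (lookup-ext λ k → trans (VecP.lookup-map k (transpose a b) u) (sym (lookup-swapʷ a b u k)))
    (transpose-<ₗ a→b u i ui≡b λ k k<i →
      (λ uk≡a → FinP.<⇒≢ (FinP.<-trans k<i i<j) (isPerm-injective {u = u} pu (trans uk≡a (sym uj≡a)))) ,
      (λ uk≡b → FinP.<⇒≢ k<i (isPerm-injective {u = u} pu (trans uk≡b (sym ui≡b)))))

-- The disjuncts are the two licences for an exchange that lowers the word: `AdjInvariant` itself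
-- and `swap-untouched`.
Reducible : Word n → Set
Reducible u = ∃₂ λ a b → Next a b × Inverted a b u × (¬ Adj a b u ⊎ ¬ Touches a b u)

Reducible? : (u : Word n) → Dec (Reducible u)
Reducible? u = any? λ a → any? λ b → (toℕ b ℕ.≟ ℕ.suc (toℕ a)) ×-dec
  (any? λ i → any? λ j → (i <? j) ×-dec ((lookup u i Fin.≟ b) ×-dec (lookup u j Fin.≟ a))) ×-dec
  (¬? (Adj? a b u) ⊎-dec ¬? (Touches? a b u))

normalise : {f : Word n → C} → AdjInvariant f → BaseInvariant f → (u : Word n) → T (isPerm u) →
            ∃ λ v → T (isPerm v) × ¬ Reducible v × f v ≡ f u
normalise {n} {f = f} adj base u pu = go u pu (Lex.<-wellFounded trans (λ { refl p → p }) Fin-<-wellFounded u)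
  where
  go : ∀ u → T (isPerm u) → Acc _<ₗ_ u → ∃ λ v → T (isPerm v) × ¬ Reducible v × f v ≡ f u
  go u pu (acc rec) with Reducible? u
  ... | no irr = u , pu , irr , refl
  ... | yes (a , b , a→b , inv , h) with go (swapʷ a b ∘ₚ u) (isPerm-swapʷ a b {u} pu) (rec (swapʷ-<ₗ a→b u pu inv))
  ...   | v , pv , irr , fv≡ = v , pv , irr , trans fv≡
    ([ adj a→b {u} pu , swap-untouched adj base (toℕ a) refl a→b u pu ]′ h)

-- Irreducible words are determined by their interior peaks.

InteriorPeak : Word n → Fin n → Set
InteriorPeak u i = ∃₂ λ h j → Next h i × Next i j × lookup u h Fin.< lookup u i × lookup u j Fin.< lookup u i

module Irreducible {n} (u : Word n) (pu : T (isPerm u)) (irr : ¬ Reducible u) where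

  inj : Injective u
  inj = isPerm-injective {u = u} pu

  inverted⇒adj : Next a b → Inverted a b u → Adj a b u
  inverted⇒adj {a = a} {b} a→b inv = decidable-stable (Adj? a b u) λ h → irr (a , b , a→b , inv , inj₁ h)

  inverted⇒touches : Next a b → Inverted a b u → Touches a b u
  inverted⇒touches {a = a} {b} a→b inv = decidable-stable (Touches? a b u) λ h → irr (a , b , a→b , inv , inj₂ h)

  inverted⇒next : {i j : Fin n} → i Fin.< j → Next (lookup u j) (lookup u i) → Next i j
  inverted⇒next {i} {j} i<j uj→ui with inverted⇒adj uj→ui (i , j , i<j , refl , refl)
  ... | x , y , x→y , inj₂ (p , q) = subst₂ Next (inj p) (inj q) x→y
  ... | x , y , x→y , inj₁ (p , q) = ⊥-elim (FinP.<-asym i<j (subst₂ Fin._<_ (inj p) (inj q) (Next⇒< {i = x} x→y)))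

  -- Otherwise all letters from u i − 1 down to u j would occur before position i.
  descend : {i j : Fin n} → i Fin.< j → lookup u j Fin.< lookup u i → ∃ λ k → Next i k × Next (lookup u k) (lookup u i)
  descend {i} {j} i<j uj<ui with predecessor (lookup u i)
  ... | inj₁ ui≡0 with () ← subst (toℕ (lookup u j) ℕ.<_) ui≡0 uj<ui
  ... | inj₂ (a , a→ui) with position u pu a
  ...   | p , refl with FinP.<-cmp p i
  ...     | tri≈ _ refl _ = ⊥-elim (ℕP.<-irrefl refl (Next⇒< {i = lookup u p} a→ui))
  ...     | tri> _ _ i<p = p , inverted⇒next i<p a→ui , a→ui
  ...     | tri< p<i _ _ = ⊥-elim (j≮i
      (before (toℕ (lookup u p) ℕ.∸ toℕ (lookup u j)) (lookup u j) (ℕP.m∸n+n≡m uj≤up) ℕP.≤-refl))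
    where
    uj≤up : lookup u j Fin.≤ lookup u p
    uj≤up = ℕP.≤-pred (subst (toℕ (lookup u j) ℕ.<_) a→ui uj<ui)
    before : ∀ k c → k ℕ.+ toℕ c ≡ toℕ (lookup u p) → lookup u j Fin.≤ c → ∃ λ q → lookup u q ≡ c × q Fin.< i
    before ℕ.zero c e _ = p , sym (toℕ-injective e) , p<i
    before (ℕ.suc k) c e uj≤c with successor {i = c} {j = lookup u p}
        (subst (toℕ c ℕ.<_) e (ℕP.m<n+m (toℕ c) (ℕ.s≤s ℕ.z≤n)))
    ... | d , c→d with before k d (trans (cong (k ℕ.+_) c→d) (trans (ℕP.+-suc k (toℕ c)) e))
        (ℕP.≤-trans uj≤c (ℕP.<⇒≤ (Next⇒< {i = c} c→d)))
    ...   | r , refl , r<i with position u pu c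
    ...     | q , refl with FinP.<-cmp q i
    ...       | tri< q<i _ _ = q , refl , q<i
    ...       | tri≈ _ refl _ = ⊥-elim (ℕP.<-irrefl refl
        (ℕP.≤-<-trans (ℕP.≤-trans (ℕP.m≤n+m _ (ℕ.suc k)) (ℕP.≤-reflexive e)) (Next⇒< {i = lookup u p} a→ui)))
    -- With c + 1 at r < i and c at q > i, this inverted pair would have to be adjacent, leaving no
    -- room for i between them.
    ...       | tri> _ _ i<q = ⊥-elim (ℕP.<-irrefl refl
        (ℕP.<-≤-trans i<q (subst (ℕ._≤ toℕ i) (sym (inverted⇒next (FinP.<-trans r<i i<q) c→d)) r<i)))
    j≮i : ¬ ∃ λ q → lookup u q ≡ lookup u j × q Fin.< i
    j≮i (q , e , q<i) = FinP.<-asym i<j (subst (Fin._< i) (inj e) q<i)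

  -- Here u k = u j - 1, so a letter below u k must touch one of the two. The remaining neighbour of
  -- u j is the larger u i, so the small letter follows k and j, k start another double descent. The
  -- number `f` counts the places left before the end of the word.
  no-double-descent : ∀ f {i j k} → f ℕ.+ toℕ i ≡ n → Next i j → Next j k →
                      lookup u j Fin.< lookup u i → ¬ lookup u k Fin.< lookup u j
  no-double-descent ℕ.zero {i} e _ _ _ _ = ℕP.<-irrefl e (toℕ<n i)
  no-double-descent (ℕ.suc f) {i} {j} {k} e i→j j→k uj<ui uk<uj with descend (Next⇒< {i = j} j→k) uk<uj
  ... | k′ , j→k′ , uk→uj with Next-functional {i = j} j→k′ j→k
  ...   | refl with inverted⇒touches uk→uj (j , k , Next⇒< {i = j} j→k , refl , refl)
  ...     | c , c<uk , inj₁ (x , y , x→y , inj₁ (refl , uy≡uk)) = last (Next-injective {i = x} (subst (Next x) (inj uy≡uk) x→y) j→k)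
    where
    last : x ≢ j
    last refl = FinP.<-asym c<uk uk<uj
  ...     | c , c<uk , inj₁ (x , y , x→y , inj₂ (ux≡uk , refl)) =
    no-double-descent f (trans (cong (f ℕ.+_) i→j) (trans (ℕP.+-suc f (toℕ i)) e)) j→k
      (subst (λ x → Next x y) (inj ux≡uk) x→y) uk<uj c<uk
  ...     | c , c<uk , inj₂ (x , y , x→y , inj₁ (refl , uy≡uj)) =
    first (Next-injective {i = x} (subst (Next x) (inj uy≡uj) x→y) i→j)
    where
    first : x ≢ i
    first refl = FinP.<-asym (FinP.<-trans c<uk uk<uj) uj<ui
  ...     | c , c<uk , inj₂ (x , y , x→y , inj₂ (ux≡uj , refl)) =
    last (Next-functional {i = j} (subst (λ x → Next x y) (inj ux≡uj) x→y) j→k)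
    where
    last : y ≢ k
    last refl = FinP.<-irrefl refl c<uk

  no-double-descent′ : {i j k : Fin n} → Next i j → Next j k → lookup u j Fin.< lookup u i → ¬ lookup u k Fin.< lookup u j
  no-double-descent′ {i} = no-double-descent (n ℕ.∸ toℕ i) (ℕP.m∸n+n≡m (ℕP.<⇒≤ (toℕ<n i)))

  -- By `descend` the letter right after i is u i - 1. If j came later, u j would be smaller still,
  -- and `descend` from that place would produce a double descent.
  inversion⇒next : {i j : Fin n} → i Fin.< j → lookup u j Fin.< lookup u i → Next i j
  inversion⇒next {i} {j} i<j uj<ui with descend i<j uj<ui
  ... | k , i→k , uk→ui with FinP.<-cmp k j
  ...   | tri≈ _ refl _ = i→k
  ...   | tri> _ _ j<k = ⊥-elim (ℕP.<-irrefl refl (ℕP.<-≤-trans i<j (ℕP.≤-pred (subst (toℕ j ℕ.<_) i→k j<k))))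
  ...   | tri< k<j _ _ with FinP.<-cmp (lookup u j) (lookup u k)
  ...     | tri≈ _ e _ = ⊥-elim (FinP.<⇒≢ k<j (sym (inj e)))
  ...     | tri> _ _ uk<uj =
    ⊥-elim (ℕP.<-irrefl refl (ℕP.<-≤-trans uk<uj (ℕP.≤-pred (subst (toℕ (lookup u j) ℕ.<_) uk→ui uj<ui))))
  ...     | tri< uj<uk _ _ with descend k<j uj<uk
  ...       | l , k→l , ul→uk =
    ⊥-elim (no-double-descent′ i→k k→l (Next⇒< {i = lookup u k} uk→ui) (Next⇒< {i = lookup u l} ul→uk))

  -- A letter below u j must touch u i or u j. To the right of j it would make a double descent, so
  -- it stands just before i.
  descent⇒peak : {i j : Fin n} → Next i j → lookup u j Fin.< lookup u i → InteriorPeak u i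
  descent⇒peak {i} {j} i→j uj<ui with descend (Next⇒< {i = i} i→j) uj<ui
  ... | j′ , i→j′ , uj→ui with Next-functional {i = i} i→j′ i→j
  ...   | refl with inverted⇒touches uj→ui (i , j , Next⇒< {i = i} i→j , refl , refl)
  ...     | c , c<uj , inj₁ (x , y , x→y , inj₁ (refl , uy≡uj)) =
    ⊥-elim (first (Next-injective {i = x} (subst (Next x) (inj uy≡uj) x→y) i→j))
    where
    first : x ≢ i
    first refl = FinP.<-asym c<uj uj<ui
  ...     | c , c<uj , inj₁ (x , y , x→y , inj₂ (ux≡uj , refl)) =
    ⊥-elim (no-double-descent′ i→j (subst (λ x → Next x y) (inj ux≡uj) x→y) uj<ui c<uj)
  ...     | c , c<uj , inj₂ (x , y , x→y , inj₁ (refl , uy≡ui)) =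
    x , j , subst (Next x) (inj uy≡ui) x→y , i→j , FinP.<-trans c<uj uj<ui , uj<ui
  ...     | c , c<uj , inj₂ (x , y , x→y , inj₂ (ux≡ui , refl)) =
    ⊥-elim (second (Next-functional {i = i} (subst (λ x → Next x y) (inj ux≡ui) x→y) i→j))
    where
    second : y ≢ j
    second refl = FinP.<-irrefl refl c<uj

open Irreducible using (inversion⇒next; descent⇒peak)

OrderEmbeds : Word n → Word n → Set
OrderEmbeds u v = ∀ i j → lookup u i Fin.< lookup u j → lookup v i Fin.< lookup v j

-- Induction on the letter u i: the place of the letter u i - 1 has a smaller letter in v as well,
-- so v i is at least one larger than what is known there.
order-embeds⇒≤ : (u v : Word n) → T (isPerm u) → OrderEmbeds u v → ∀ i → lookup u i Fin.≤ lookup v i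
order-embeds⇒≤ u v pu u⊑v i = go (toℕ (lookup u i)) i refl
  where
  go : ∀ k i → toℕ (lookup u i) ≡ k → k ℕ.≤ toℕ (lookup v i)
  go ℕ.zero i _ = ℕ.z≤n
  go (ℕ.suc k) i e with predecessor (lookup u i)
  ... | inj₁ ui≡0 with () ← trans (sym ui≡0) e
  ... | inj₂ (a , a→ui) with position u pu a
  ...   | j , refl = ℕP.≤-<-trans (go k j (ℕP.suc-injective (trans (sym a→ui) e))) (u⊑v j i (Next⇒< {i = lookup u j} a→ui))

-- An inversion of an irreducible word is the descent just after an interior peak, and v shares that
-- peak.
inversion-transfer : {u v : Word n} → T (isPerm u) → ¬ Reducible u → (∀ i → InteriorPeak u i → InteriorPeak v i) →
  ∀ {i j} → i Fin.< j → lookup u j Fin.< lookup u i → lookup v j Fin.< lookup v i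
inversion-transfer {u = u} {v} pu iu u⇒v {i} {j} i<j uj<ui with inversion⇒next u pu iu i<j uj<ui
... | i→j with u⇒v i (descent⇒peak u pu iu i→j uj<ui)
...   | _ , j′ , _ , i→j′ , _ , vj′<vi =
  subst (λ j → lookup v j Fin.< lookup v i) (Next-functional {i = i} i→j′ i→j) vj′<vi

irreducible-order-embeds : (u v : Word n) → T (isPerm u) → T (isPerm v) → ¬ Reducible u → ¬ Reducible v →
  (∀ i → InteriorPeak u i → InteriorPeak v i) → (∀ i → InteriorPeak v i → InteriorPeak u i) → OrderEmbeds u v
irreducible-order-embeds u v pu pv iu iv u⇒v v⇒u i j ui<uj with FinP.<-cmp i j
... | tri≈ _ refl _ = ⊥-elim (FinP.<-irrefl refl ui<uj)
... | tri> _ _ j<i = inversion-transfer {u = u} {v} pu iu u⇒v j<i ui<uj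
... | tri< i<j _ _ with FinP.<-cmp (lookup v i) (lookup v j)
...   | tri< vi<vj _ _ = vi<vj
...   | tri≈ _ e _ = ⊥-elim (FinP.<⇒≢ i<j (isPerm-injective {u = v} pv e))
...   | tri> _ _ vj<vi = ⊥-elim (FinP.<-asym ui<uj (inversion-transfer {u = v} {u} pv iv v⇒u i<j vj<vi))

irreducible-unique : (u v : Word n) → T (isPerm u) → T (isPerm v) → ¬ Reducible u → ¬ Reducible v →
  (∀ i → InteriorPeak u i → InteriorPeak v i) → (∀ i → InteriorPeak v i → InteriorPeak u i) → u ≡ v
irreducible-unique u v pu pv iu iv u⇒v v⇒u = lookup-ext λ i → FinP.≤-antisym
  (order-embeds⇒≤ u v pu (irreducible-order-embeds u v pu pv iu iv u⇒v v⇒u) i)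
  (order-embeds⇒≤ v u pv (irreducible-order-embeds v u pv pu iv iu v⇒u u⇒v) i)

-- Peak sets under exchange of letters.

T-ext : ∀ {p q} → (T p → T q) → (T q → T p) → p ≡ q
T-ext {true} {true} _ _ = refl
T-ext {true} {false} f _ = ⊥-elim (f _)
T-ext {false} {true} _ g = ⊥-elim (g _)
T-ext {false} {false} _ _ = refl

_<ᶠ_ : Fin n → Fin n → Bool
i <ᶠ j = toℕ i <ᵇ toℕ j

<ᶠ⇒< : {i j : Fin n} → T (i <ᶠ j) → i Fin.< j
<ᶠ⇒< {i = i} {j} = ℕP.<ᵇ⇒< (toℕ i) (toℕ j)

<⇒<ᶠ : {i j : Fin n} → i Fin.< j → T (i <ᶠ j)
<⇒<ᶠ = ℕP.<⇒<ᵇ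

summit : (p q r : Fin n) → Bool
summit p q r = (p <ᶠ q) ∧ (r <ᶠ q)

summit⁻ : (p q r : Fin n) → T (summit p q r) → p Fin.< q × r Fin.< q
summit⁻ p q r t with Equivalence.to (T-∧ {p <ᶠ q} {r <ᶠ q}) t
... | p<q , r<q = <ᶠ⇒< p<q , <ᶠ⇒< r<q

summit⁺ : (p q r : Fin n) → p Fin.< q → r Fin.< q → T (summit p q r)
summit⁺ p q r p<q r<q = Equivalence.from (T-∧ {p <ᶠ q} {r <ᶠ q}) (<⇒<ᶠ p<q , <⇒<ᶠ r<q)

at-letters : (v : Vec (Fin n) m) (i : Fin m) → at (map (λ k → ℕ.suc (toℕ k)) (vtoList v)) (toℕ i) ≡ ℕ.suc (toℕ (lookup v i))
at-letters (x ∷ v) zero = refl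
at-letters (x ∷ v) (suc i) = at-letters v i

-- The left comparison is with w₀ = 0, and it holds because `vals` counts letters from 1.
isPeakAt-first : (w : Word n) {i j : Fin n} → toℕ i ≡ 0 → Next i j →
                 isPeakAt w (ℕ.suc (toℕ i)) ≡ (lookup w j <ᶠ lookup w i)
isPeakAt-first w@(x ∷ _) {zero} {j} refl i→j =
  cong (_<ᵇ ℕ.suc (toℕ x)) (trans (cong (at (vals w) ∘ ℕ.suc) (sym i→j)) (at-letters w j))

isPeakAt-interior : (w : Word n) {h i j : Fin n} → Next h i → Next i j →
  isPeakAt w (ℕ.suc (toℕ i)) ≡ summit (lookup w h) (lookup w i) (lookup w j)
isPeakAt-interior w {h} {i} {j} h→i i→j = cong₂ _∧_
  (cong₂ _<ᵇ_ (trans (cong (at (vals w)) h→i) (at-letters w h)) (at-letters w i))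
  (cong₂ _<ᵇ_ (trans (cong (at (vals w) ∘ ℕ.suc) (sym i→j)) (at-letters w j)) (at-letters w i))

∈-range1⁺ : {i j : Fin n} → Next i j → ℕ.suc (toℕ i) ∈ range1 n
∈-range1⁺ {ℕ.suc n} {i} {j} i→j = ∈-map⁺ ℕ.suc (∈-upTo⁺ (ℕP.≤-pred (subst (ℕ._< ℕ.suc n) i→j (toℕ<n j))))

∈-range1⁻ : ∀ {p} → p ∈ range1 n → ∃₂ λ (i j : Fin n) → Next i j × p ≡ ℕ.suc (toℕ i)
∈-range1⁻ {ℕ.suc n} p∈ with ∈-map⁻ ℕ.suc p∈
... | k , k∈ , refl = inject₁ i′ , suc i′ , cong ℕ.suc (sym (toℕ-inject₁ i′)) ,
    cong ℕ.suc (trans (sym (toℕ-fromℕ< k<n)) (sym (toℕ-inject₁ i′)))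
  where
  k<n = ∈-upTo⁻ k∈
  i′ = fromℕ< k<n

Peak-cong : {u v : Word n} →
  (∀ {i j} → Next i j → isPeakAt u (ℕ.suc (toℕ i)) ≡ isPeakAt v (ℕ.suc (toℕ i))) → Peak u ≡ Peak v
Peak-cong {n} {u} {v} h = filterB-cong (range1 n) eq
  where
  eq : ∀ {p} → p ∈ range1 n → isPeakAt u p ≡ isPeakAt v p
  eq p∈ with ∈-range1⁻ {n} p∈
  ... | _ , _ , i→j , refl = h i→j

IPeak-cong : {u v : Word n} →
  (∀ {h i j} → Next h i → Next i j → isPeakAt u (ℕ.suc (toℕ i)) ≡ isPeakAt v (ℕ.suc (toℕ i))) → IPeak u ≡ IPeak v
IPeak-cong {n} {u} {v} h = filterB-cong (range1 n) eq
  where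
  eq : ∀ {p} → p ∈ range1 n → (1 <ᵇ p) ∧ isPeakAt u p ≡ (1 <ᵇ p) ∧ isPeakAt v p
  eq p∈ with ∈-range1⁻ {n} p∈
  ... | i , j , i→j , refl with predecessor i
  ...   | inj₁ i≡0 rewrite i≡0 = refl
  ...   | inj₂ (_ , h→i) = cong ((1 <ᵇ ℕ.suc (toℕ i)) ∧_) (h h→i i→j)

interiorPeak-cong : {u v : Word n} → IPeak u ≡ IPeak v → ∀ i → InteriorPeak u i → InteriorPeak v i
interiorPeak-cong {n} {u} {v} e i (h , j , h→i , i→j , uh<ui , uj<ui) = h , j , h→i , i→j , split
  where
  p∈ : ℕ.suc (toℕ i) ∈ IPeak u
  p∈ = ∈-filterB⁺ (λ p → (1 <ᵇ p) ∧ isPeakAt u p) (∈-range1⁺ {i = i} {j} i→j)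
    (Equivalence.from T-∧ (subst (λ k → T (1 <ᵇ ℕ.suc k)) (sym h→i) _ ,
      subst T (sym (isPeakAt-interior u {h} {i} {j} h→i i→j)) (summit⁺ _ _ _ uh<ui uj<ui)))
  peak : T (isPeakAt v (ℕ.suc (toℕ i)))
  peak = proj₂ (Equivalence.to (T-∧ {1 <ᵇ ℕ.suc (toℕ i)})
    (proj₂ (∈-filterB⁻ (λ p → (1 <ᵇ p) ∧ isPeakAt v p) {xs = range1 n} (subst (ℕ.suc (toℕ i) ∈_) e p∈))))
  split = summit⁻ _ _ _ (subst T (isPeakAt-interior v {h} {i} {j} h→i i→j) peak)

-- No letter lies between a and b, so only the comparison of a with b itself can be reversed.
transpose-mono : Next a b → c Fin.< d → ¬ (c ≡ a × d ≡ b) → transpose a b c Fin.< transpose a b d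
transpose-mono {a = a} {b} {c} {d} a→b c<d ¬ab with transpose a b c | transposed a b c | transpose a b d | transposed a b d
... | _ | matchˡ refl | _ | matchˡ refl = ⊥-elim (FinP.<-irrefl refl c<d)
... | _ | matchˡ refl | _ | matchʳ refl = ⊥-elim (¬ab (refl , refl))
... | _ | matchˡ refl | _ | mismatch _ d≢b = FinP.≤∧≢⇒< (subst (ℕ._≤ toℕ d) (sym a→b) c<d) (d≢b ∘ sym)
... | _ | matchʳ refl | _ | matchˡ refl = ⊥-elim (FinP.<-asym c<d (Next⇒< {i = d} a→b))
... | _ | matchʳ refl | _ | matchʳ refl = ⊥-elim (FinP.<-irrefl refl c<d)
... | _ | matchʳ refl | _ | mismatch _ _ = FinP.<-trans (Next⇒< {i = a} a→b) c<d
... | _ | mismatch _ _ | _ | matchˡ refl = FinP.<-trans c<d (Next⇒< {i = a} a→b)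
... | _ | mismatch c≢a _ | _ | matchʳ refl = FinP.≤∧≢⇒< (ℕP.≤-pred (subst (toℕ c ℕ.<_) a→b c<d)) c≢a
... | _ | mismatch _ _ | _ | mismatch _ _ = c<d

transpose-shift : transpose a b c ≡ d → c ≡ transpose a b d
transpose-shift {a = a} {b} {c} e = trans (sym (transpose-involutive a b c)) (cong (transpose a b) e)

transpose-<ᶠ : Next a b → ¬ ((c ≡ a × d ≡ b) ⊎ (c ≡ b × d ≡ a)) → (transpose a b c <ᶠ transpose a b d) ≡ (c <ᶠ d)
transpose-<ᶠ {a = a} {b} {c} {d} a→b ¬pair = T-ext
  (λ lt → <⇒<ᶠ (subst₂ Fin._<_ (transpose-involutive a b c) (transpose-involutive a b d)
    (transpose-mono a→b (<ᶠ⇒< lt) λ (p , q) →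
      ¬pair (inj₂ (trans (transpose-shift p) (transpose-matchˡ a b) , trans (transpose-shift q) (transpose-matchʳ a b))))))
  (λ lt → <⇒<ᶠ (transpose-mono a→b (<ᶠ⇒< lt) (¬pair ∘ inj₁)))

swapʷ-<ᶠ : Next a b → (u : Word n) {i j : Fin n} →
  ¬ ((lookup u i ≡ a × lookup u j ≡ b) ⊎ (lookup u i ≡ b × lookup u j ≡ a)) →
  (lookup (swapʷ a b ∘ₚ u) i <ᶠ lookup (swapʷ a b ∘ₚ u) j) ≡ (lookup u i <ᶠ lookup u j)
swapʷ-<ᶠ {a = a} {b} a→b u {i} {j} ¬pair =
  trans (cong₂ _<ᶠ_ (lookup-swapʷ a b u i) (lookup-swapʷ a b u j)) (transpose-<ᶠ a→b ¬pair)

pair-swap : {P Q R S : Set} → (P × Q) ⊎ (R × S) → (S × R) ⊎ (Q × P)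
pair-swap (inj₁ (p , q)) = inj₂ (q , p)
pair-swap (inj₂ (r , s)) = inj₁ (s , r)

isPeakAt-adjInvariant : Next a b → {u : Word n} → ¬ Adj a b u → ∀ {i j} → Next i j →
  isPeakAt (swapʷ a b ∘ₚ u) (ℕ.suc (toℕ i)) ≡ isPeakAt u (ℕ.suc (toℕ i))
isPeakAt-adjInvariant {a = a} {b} a→b {u} ¬adj {i} {j} i→j with predecessor i
... | inj₁ i≡0 = trans (isPeakAt-first (swapʷ a b ∘ₚ u) {i} {j} i≡0 i→j)
  (trans (swapʷ-<ᶠ a→b u λ h → ¬adj (i , j , i→j , pair-swap h)) (sym (isPeakAt-first u {i} {j} i≡0 i→j)))
... | inj₂ (h , h→i) = trans (isPeakAt-interior (swapʷ a b ∘ₚ u) {h} {i} {j} h→i i→j)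
  (trans (cong₂ _∧_ (swapʷ-<ᶠ a→b u λ p → ¬adj (h , i , h→i , p)) (swapʷ-<ᶠ a→b u λ p → ¬adj (i , j , i→j , pair-swap p)))
    (sym (isPeakAt-interior u {h} {i} {j} h→i i→j)))

Peak-adjInvariant : AdjInvariant (Peak {n})
Peak-adjInvariant {a = a} {b} a→b {u} _ ¬adj =
  Peak-cong {u = swapʷ a b ∘ₚ u} {u} λ {i} {j} → isPeakAt-adjInvariant a→b {u} ¬adj {i} {j}

IPeak-adjInvariant : AdjInvariant (IPeak {n})
IPeak-adjInvariant {a = a} {b} a→b {u} _ ¬adj =
  IPeak-cong {u = swapʷ a b ∘ₚ u} {u} λ {_} {i} {j} _ → isPeakAt-adjInvariant a→b {u} ¬adj {i} {j}

-- A letter larger than two distinct letters is neither a nor b.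
transpose-base-peak : toℕ a ≡ 0 → toℕ b ≡ 1 → {p q r : Fin n} → p ≢ r → p Fin.< q → r Fin.< q →
  transpose a b p Fin.< transpose a b q × transpose a b r Fin.< transpose a b q
transpose-base-peak {a = a} {b} a≡0 b≡1 {p} {q} {r} p≢r p<q r<q = mono p<q , mono r<q
  where
  a→b : Next a b
  a→b = trans b≡1 (cong ℕ.suc (sym a≡0))
  q≢b : q ≢ b
  q≢b refl = p≢r (toℕ-injective (trans (zero′ p<q) (sym (zero′ r<q))))
    where
    zero′ : ∀ {k : Fin _} → k Fin.< q → toℕ k ≡ 0
    zero′ k<q = ℕP.n≤0⇒n≡0 (ℕP.≤-pred (subst (_ ℕ.<_) b≡1 k<q))
  mono : ∀ {k} → k Fin.< q → transpose a b k Fin.< transpose a b q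
  mono k<q = transpose-mono a→b k<q (q≢b ∘ proj₂)

isPeakAt-base : toℕ a ≡ 0 → toℕ b ≡ 1 → {u : Word n} → T (isPerm u) → ∀ {h i j} → Next h i → Next i j →
  isPeakAt (swapʷ a b ∘ₚ u) (ℕ.suc (toℕ i)) ≡ isPeakAt u (ℕ.suc (toℕ i))
isPeakAt-base {a = a} {b} a≡0 b≡1 {u} pu {h} {i} {j} h→i i→j = begin
  isPeakAt (swapʷ a b ∘ₚ u) (ℕ.suc (toℕ i))             ≡⟨ isPeakAt-interior (swapʷ a b ∘ₚ u) {h} {i} {j} h→i i→j ⟩
  summit (lookup u′ h) (lookup u′ i) (lookup u′ j)        ≡⟨ cong₂ _∧_ (cong₂ _<ᶠ_ (at′ h) (at′ i)) (cong₂ _<ᶠ_ (at′ j) (at′ i)) ⟩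
  summit (τ (lookup u h)) (τ (lookup u i)) (τ (lookup u j)) ≡⟨ T-ext bwd fwd ⟩
  summit (lookup u h) (lookup u i) (lookup u j)           ≡⟨ isPeakAt-interior u {h} {i} {j} h→i i→j ⟨
  isPeakAt u (ℕ.suc (toℕ i))                            ∎
  where
  open ≡-Reasoning
  u′ = swapʷ a b ∘ₚ u
  τ = transpose a b
  at′ = lookup-swapʷ a b u
  uh≢uj : lookup u h ≢ lookup u j
  uh≢uj e = FinP.<⇒≢ (FinP.<-trans (Next⇒< {i = h} h→i) (Next⇒< {i = i} i→j)) (isPerm-injective {u = u} pu e)
  raise : ∀ {p q r} → p ≢ r → T (summit p q r) → T (summit (τ p) (τ q) (τ r))
  raise {p} {q} {r} p≢r t with summit⁻ p q r t
  ... | p<q , r<q with transpose-base-peak a≡0 b≡1 p≢r p<q r<q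
  ...   | p<q′ , r<q′ = summit⁺ (τ p) (τ q) (τ r) p<q′ r<q′
  fwd = raise {lookup u h} {lookup u i} {lookup u j} uh≢uj
  bwd : T (summit (τ (lookup u h)) (τ (lookup u i)) (τ (lookup u j))) → T (summit (lookup u h) (lookup u i) (lookup u j))
  -- The exchange is an involution, so the converse is `raise` for the letters already exchanged.
  bwd t with raise {τ (lookup u h)} {τ (lookup u i)} {τ (lookup u j)}
    (λ e → uh≢uj (trans (transpose-shift e) (transpose-involutive a b _))) t
  ... | t′ rewrite transpose-involutive a b (lookup u h)
    | transpose-involutive a b (lookup u i)
    | transpose-involutive a b (lookup u j) = t′

IPeak-baseInvariant : BaseInvariant (IPeak {n})
IPeak-baseInvariant {a = a} {b} a≡0 b≡1 {u} pu =
  IPeak-cong {u = swapʷ a b ∘ₚ u} {u} λ {h} {i} {j} → isPeakAt-base a≡0 b≡1 {u} pu {h} {i} {j}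

-- Interior positions are safe by `isPeakAt-base`. Position 1 only compares the first two letters,
-- and that comparison changes only if they are 1 and 2, which is the excluded case.
Peak-baseInvariantOffFixes : BaseInvariantOffFixes (Peak {n})
Peak-baseInvariantOffFixes {n} {a = a} {b} a≡0 b≡1 {u} pu ¬fix = Peak-cong {u = swapʷ a b ∘ₚ u} {u} eq
  where
  a→b : Next a b
  a→b = trans b≡1 (cong ℕ.suc (sym a≡0))
  eq : ∀ {i j} → Next i j → isPeakAt (swapʷ a b ∘ₚ u) (ℕ.suc (toℕ i)) ≡ isPeakAt u (ℕ.suc (toℕ i))
  eq {i} {j} i→j with predecessor i
  ... | inj₂ (h , h→i) = isPeakAt-base a≡0 b≡1 {u} pu {h} {i} {j} h→i i→j
  ... | inj₁ i≡0 with toℕ-injective {i = i} {a} (trans i≡0 (sym a≡0))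
  ...   | refl with toℕ-injective {i = j} {b} (trans i→j (sym a→b))
  ...     | refl = trans (isPeakAt-first (swapʷ a b ∘ₚ u) {i} {j} i≡0 i→j)
    (trans (swapʷ-<ᶠ a→b u λ h → ¬fix (pair-swap h)) (sym (isPeakAt-first u {i} {j} i≡0 i→j)))

-- Both words are lowered to irreducible ones, which have the same interior peaks and hence
-- coincide.
factor-through-IPeak : {f : Word n → C} → AdjInvariant f → BaseInvariant f →
  {u v : Word n} → T (isPerm u) → T (isPerm v) →
                       IPeak u ≡ IPeak v → f u ≡ f v
factor-through-IPeak {n} {f = f} adj base {u} {v} pu pv e
  with normalise g-adj g-base u pu | normalise g-adj g-base v pv
  where
  g : Word n → _
  -- Normalising for the pair preserves the interior peak set along with the value of `f`.
  g w = f w , IPeak w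
  g-adj : AdjInvariant g
  g-adj a→b {w} pw ¬adj = cong₂ _,_ (adj a→b {w} pw ¬adj) (IPeak-adjInvariant a→b {w} pw ¬adj)
  g-base : BaseInvariant g
  g-base a≡0 b≡1 {w} pw = cong₂ _,_ (base a≡0 b≡1 {w} pw) (IPeak-baseInvariant a≡0 b≡1 {w} pw)
... | u′ , pu′ , iu , gu | v′ , pv′ , iv , gv = trans (sym (cong proj₁ gu)) (trans (cong f u′≡v′) (cong proj₁ gv))
  where
  e′ : IPeak u′ ≡ IPeak v′
  e′ = trans (cong proj₂ gu) (trans e (sym (cong proj₂ gv)))
  u′≡v′ : u′ ≡ v′
  u′≡v′ = irreducible-unique u′ v′ pu′ pv′ iu iv
    (interiorPeak-cong {u = u′} {v′} e′) (interiorPeak-cong {u = v′} {u′} (sym e′))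

-- Membership in the spans, and the ideal property.

∈-sublists⇒⊆ : {G xs : List A} → G ∈ sublists xs → ∀ {x} → x ∈ G → x ∈ xs
∈-sublists⇒⊆ {xs = []} (here refl) ()
∈-sublists⇒⊆ {xs = y ∷ xs} G∈ x∈ with ∈-++⁻ (map (y ∷_) (sublists xs)) G∈
... | inj₂ G∈′ = there (∈-sublists⇒⊆ G∈′ x∈)
... | inj₁ G∈′ with ∈-map⁻ (y ∷_) G∈′
∈-sublists⇒⊆ {xs = y ∷ xs} G∈ (here refl) | inj₁ _ | _ , _ , refl = here refl
∈-sublists⇒⊆ {xs = y ∷ xs} G∈ (there x∈) | inj₁ _ | _ , H∈ , refl = there (∈-sublists⇒⊆ H∈ x∈)

sublists-unique : {xs : List A} → Unique xs → Unique (sublists xs)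
sublists-unique {xs = []} _ = [] ∷ []
sublists-unique {xs = x ∷ xs} (x∉ ∷ u) =
  UniqueP.++⁺ (UniqueP.map⁺ ListP.∷-injectiveʳ (sublists-unique u)) (sublists-unique u) disjoint
  where
  disjoint : ∀ {G} → G ∈ map (x ∷_) (sublists xs) × G ∈ sublists xs → ⊥
  disjoint (p , q) with ∈-map⁻ (x ∷_) p
  ... | _ , _ , refl = All.lookup x∉ (∈-sublists⇒⊆ q (here refl)) refl

filterB∈sublists : (p : A → Bool) (xs : List A) → filterB p xs ∈ sublists xs
filterB∈sublists p [] = here refl
filterB∈sublists p (x ∷ xs) with p x
... | true = ∈-++⁺ˡ (∈-map⁺ (x ∷_) (filterB∈sublists p xs))
... | false = ∈-++⁺ʳ (map (x ∷_) (sublists xs)) (filterB∈sublists p xs)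

filterB-map : (p : B → Bool) (h : A → B) (xs : List A) → filterB p (map h xs) ≡ map h (filterB (p ∘ h) xs)
filterB-map p h [] = refl
filterB-map p h (x ∷ xs) with p (h x)
... | true = cong (h x ∷_) (filterB-map p h xs)
... | false = filterB-map p h xs

filterB-∧ : (p q : A → Bool) (xs : List A) → filterB (λ x → q x ∧ p x) xs ≡ filterB q (filterB p xs)
filterB-∧ p q [] = refl
filterB-∧ p q (x ∷ xs) with p x
filterB-∧ p q (x ∷ xs) | true with q x
... | true = cong (x ∷_) (filterB-∧ p q xs)
... | false = filterB-∧ p q xs
filterB-∧ p q (x ∷ xs) | false with q x
... | true = filterB-∧ p q xs
... | false = filterB-∧ p q xs

range1-unique : ∀ n → Unique (range1 n)
range1-unique n = UniqueP.map⁺ ℕP.suc-injective (UniqueP.upTo⁺ (n ∸ 1))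

T-not : ∀ {b} → ¬ T b → T (not b)
T-not {true} h = h _
T-not {false} _ = _

noConsec-separated : (p : ℕ → Bool) → (∀ k → T (p k) → ¬ T (p (ℕ.suc k))) →
                     (L : List ℕ) → (∀ {k} → k ∈ L → T (p k)) → T (noConsec L)
noConsec-separated p sep [] _ = _
noConsec-separated p sep (k ∷ []) _ = _
noConsec-separated p sep (k ∷ l ∷ L) h = Equivalence.from T-∧
  (T-not (λ e → sep k (h (here refl)) (subst (T ∘ p) (sym (ℕP.≡ᵇ⇒≡ (ℕ.suc k) l e)) (h (there (here refl))))) ,
   noConsec-separated p sep (l ∷ L) (h ∘ there))

notHas1-large : (L : List ℕ) → (∀ {k} → k ∈ L → T (1 <ᵇ k)) → T (notHas1 L)
notHas1-large [] _ = _
notHas1-large (k ∷ L) h = Equivalence.from T-∧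
  (T-not (λ e → absurd (subst (λ k → T (1 <ᵇ k)) (ℕP.≡ᵇ⇒≡ k 1 e) (h (here refl)))) , notHas1-large L (h ∘ there))
  where
  absurd : ¬ T (1 <ᵇ 1)
  absurd ()

isPeakAt-separated : (w : Word n) → ∀ k → T (isPeakAt w k) → ¬ T (isPeakAt w (ℕ.suc k))
isPeakAt-separated w k t t′ = ℕP.<-asym
  (ℕP.<ᵇ⇒< (at (vals w) (ℕ.suc k)) (at (vals w) k) (proj₂ (Equivalence.to (T-∧ {at (vals w) (k ∸ 1) <ᵇ at (vals w) k}) t)))
  (ℕP.<ᵇ⇒< (at (vals w) k) (at (vals w) (ℕ.suc k)) (proj₁ (Equivalence.to (T-∧ {at (vals w) k <ᵇ at (vals w) (ℕ.suc k)}) t′)))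

Peak∈𝓕 : (w : Word n) → Peak w ∈ 𝓕 n
Peak∈𝓕 {n} w = ∈-filterB⁺ noConsec (filterB∈sublists (isPeakAt w) (range1 n))
  (noConsec-separated (isPeakAt w) (isPeakAt-separated w) (Peak w) (proj₂ ∘ ∈-filterB⁻ (isPeakAt w) {xs = range1 n}))

IPeak∈𝓕̊ : (w : Word n) → IPeak w ∈ 𝓕̊ n
IPeak∈𝓕̊ {n} w = ∈-filterB⁺ (λ F → noConsec F ∧ notHas1 F) (filterB∈sublists p (range1 n))
  (Equivalence.from T-∧
    (noConsec-separated (isPeakAt w) (isPeakAt-separated w) (IPeak w) (λ k∈ → proj₂ (split k∈)) ,
     notHas1-large (IPeak w) (λ k∈ → proj₁ (split k∈))))
  where
  p : ℕ → Bool
  p i = (1 <ᵇ i) ∧ isPeakAt w i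
  split : ∀ {k} → k ∈ IPeak w → T (1 <ᵇ k) × T (isPeakAt w k)
  split {k} k∈ = Equivalence.to (T-∧ {1 <ᵇ k}) (proj₂ (∈-filterB⁻ p {xs = range1 n} k∈))

sumL-indicator : {Fs : List (List ℕ)} {b : Bool} {G : List ℕ} → Unique Fs → T b → G ∈ Fs → (c : List ℕ → ℚ) →
                 sumL Fs (λ F → c F * (if b ∧ (G ==ˡ F) then 1ℚ else 0ℚ)) ≡ c G
sumL-indicator {Fs} {true} {G} u _ G∈ c = trans (sumL-single u G∈ off) on
  where
  off : ∀ {F} → F ∈ Fs → F ≢ G → c F * (if G ==ˡ F then 1ℚ else 0ℚ) ≡ 0ℚ
  off {F} _ F≢G with ListP.≡-dec ℕ._≟_ G F
  ... | yes G≡F = ⊥-elim (F≢G (sym G≡F))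
  ... | no _ = ℚP.*-zeroʳ (c F)
  on : c G * (if G ==ˡ G then 1ℚ else 0ℚ) ≡ c G
  on with ListP.≡-dec ℕ._≟_ G G
  ... | yes _ = ℚP.*-identityʳ (c G)
  ... | no G≢G = ⊥-elim (G≢G refl)

lincomb-P : (c : List ℕ → ℚ) (w : Word n) → T (isPerm w) → lincomb (𝓕 n) c (P n) w ≡ c (Peak w)
lincomb-P {n} c w pw = sumL-indicator (filterB-unique noConsec (sublists-unique (range1-unique n))) pw (Peak∈𝓕 w) c

lincomb-P̊ : (c : List ℕ → ℚ) (w : Word n) → T (isPerm w) → lincomb (𝓕̊ n) c (P̊ n) w ≡ c (IPeak w)
lincomb-P̊ {n} c w pw = sumL-indicator (filterB-unique _ (sublists-unique (range1-unique n))) pw (IPeak∈𝓕̊ w) c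

-- The form in which span membership is used: the sums `P n F` have disjoint supports covering all
-- permutations, so lying in their span means that the coefficient of w depends only on its peak
-- set. The same holds for `P̊ n F`.
FactorsThrough : (Word n → List ℕ) → QS n → Set
FactorsThrough {n} F x = ∃ λ (c : List ℕ → ℚ) → ∀ {w} → T (isPerm w) → x w ≡ c (F w)

In𝔓⁻ : {x : QS n} → In𝔓 n x → FactorsThrough Peak x
In𝔓⁻ (c , x≈) = c , λ {w} pw → trans (x≈ w pw) (lincomb-P c w pw)

In𝔓⁺ : {x : QS n} → FactorsThrough Peak x → In𝔓 n x
In𝔓⁺ (c , x≡) = c , λ w pw → trans (x≡ pw) (sym (lincomb-P c w pw))

In𝔓̊⁻ : {x : QS n} → In𝔓̊ n x → FactorsThrough IPeak x
In𝔓̊⁻ (c , x≈) = c , λ {w} pw → trans (x≈ w pw) (lincomb-P̊ c w pw)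

In𝔓̊⁺ : {x : QS n} → FactorsThrough IPeak x → In𝔓̊ n x
In𝔓̊⁺ (c , x≡) = c , λ w pw → trans (x≡ pw) (sym (lincomb-P̊ c w pw))

𝔓̊⊆𝔓 : {x : QS n} → In𝔓̊ n x → In𝔓 n x
𝔓̊⊆𝔓 {n} x∈ with In𝔓̊⁻ x∈
-- The interior peak set is the peak set with 1 removed.
... | c , x≡ = In𝔓⁺ (c ∘ filterB (1 <ᵇ_) , λ {w} pw → trans (x≡ pw) (cong c (filterB-∧ (isPeakAt w) (1 <ᵇ_) (range1 n))))

𝔓-adjInvariant : {x : QS n} → In𝔓 n x → AdjInvariant x
𝔓-adjInvariant x∈ {a} {b} a→b {u} pu ¬adj with In𝔓⁻ x∈
... | c , x≡ = trans (x≡ (isPerm-swapʷ a b {u} pu)) (trans (cong c (Peak-adjInvariant a→b {u} pu ¬adj)) (sym (x≡ pu)))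

𝔓-baseInvariantOffFixes : {x : QS n} → In𝔓 n x → BaseInvariantOffFixes x
𝔓-baseInvariantOffFixes x∈ {a} {b} a≡0 b≡1 {u} pu ¬fix with In𝔓⁻ x∈
... | c , x≡ = trans (x≡ (isPerm-swapʷ a b {u} pu))
  (trans (cong c (Peak-baseInvariantOffFixes a≡0 b≡1 {u} pu ¬fix)) (sym (x≡ pu)))

𝔓̊-baseInvariant : {x : QS n} → In𝔓̊ n x → BaseInvariant x
𝔓̊-baseInvariant x∈ {a} {b} a≡0 b≡1 {u} pu with In𝔓̊⁻ x∈
... | c , x≡ = trans (x≡ (isPerm-swapʷ a b {u} pu))
  (trans (cong c (IPeak-baseInvariant a≡0 b≡1 {u} pu)) (sym (x≡ pu)))

invariant⇒𝔓̊ : {x : QS n} → AdjInvariant x → BaseInvariant x → In𝔓̊ n x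
invariant⇒𝔓̊ {n} {x} adj base = In𝔓̊⁺ (coeff , λ {w} → x≡ w)
  where
  firstValue : List (Word n) → ℚ
  firstValue [] = 0ℚ
  firstValue (u ∷ _) = x u
  coeff : List ℕ → ℚ
  -- The coefficient is read off at the first permutation with interior peak set `F`, with 0 if
  -- there is none; `factor-through-IPeak` makes the choice immaterial.
  coeff F = firstValue (filterB (λ u → IPeak u ==ˡ F) (perms n))
  x≡ : ∀ w → T (isPerm w) → x w ≡ coeff (IPeak w)
  x≡ w pw = value (filterB p (perms n)) refl
    where
    p : Word n → Bool
    p u = IPeak u ==ˡ IPeak w
    p-sound : ∀ u → T (p u) → IPeak u ≡ IPeak w
    p-sound u t with ListP.≡-dec ℕ._≟_ (IPeak u) (IPeak w)
    ... | yes e = e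
    p-self : T (p w)
    p-self with ListP.≡-dec ℕ._≟_ (IPeak w) (IPeak w)
    ... | yes _ = _
    ... | no ¬e = ⊥-elim (¬e refl)
    value : ∀ L → filterB p (perms n) ≡ L → x w ≡ firstValue L
    value [] e with () ← subst (w ∈_) e (∈-filterB⁺ p (∈-perms⁺ pw) p-self)
    value (u ∷ L) e with ∈-filterB⁻ p {xs = perms n} (subst (u ∈_) (sym e) (here refl))
    ... | u∈ , t = factor-through-IPeak adj base {w} {u} pw (∈-perms⁻ u∈) (sym (p-sound u t))

𝔓̊-ideal : ∀ n → IsTwoSidedIdealOf𝔓 n
𝔓̊-ideal n = (λ _ → 𝔓̊⊆𝔓) , λ x y x∈ y∈ →
  invariant⇒𝔓̊ (*ₐ-adjInvariant (𝔓-adjInvariant (𝔓̊⊆𝔓 x∈)) (𝔓-adjInvariant y∈))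
    (*ₐ-baseInvariantˡ (𝔓̊-baseInvariant x∈)) ,
  invariant⇒𝔓̊ (*ₐ-adjInvariant (𝔓-adjInvariant y∈) (𝔓-adjInvariant (𝔓̊⊆𝔓 x∈)))
    (*ₐ-baseInvariantʳ (𝔓-baseInvariantOffFixes y∈) (𝔓̊-baseInvariant x∈))

-- Words beginning with 12 or 21.

suc² : Fin n → Fin (suc (suc n))
suc² k = suc (suc k)

bump : Vec (Fin n) m → Vec (Fin (suc (suc n))) m
bump = Vec.map suc²

-- The word 12w with the letters of w raised by 2: the embedding of the smaller symmetric group as
-- the stabiliser of 1 and 2. Then `s₁ (up w)` is 21w.
up : Word n → Word (suc (suc n))
up w = zero ∷ suc zero ∷ bump w

s₁ : Word (suc (suc n)) → Word (suc (suc n))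
s₁ u = swapʷ zero (suc zero) ∘ₚ u

isPerm-s₁ : {u : Word (suc (suc n))} → T (isPerm u) → T (isPerm (s₁ u))
isPerm-s₁ {u = u} = isPerm-swapʷ zero (suc zero) {u}

s₁-involutive : (u : Word (suc (suc n))) → s₁ (s₁ u) ≡ u
s₁-involutive = swapʷ-involutive zero (suc zero)

lookup-bump : (v : Vec (Fin n) m) (i : Fin m) → lookup (bump v) i ≡ suc (suc (lookup v i))
lookup-bump v i = VecP.lookup-map i suc² v

bump-injective : {u v : Vec (Fin n) m} → bump u ≡ bump v → u ≡ v
bump-injective {u = u} {v} e = lookup-ext λ i → suc-injective (suc-injective
  (trans (sym (lookup-bump u i)) (trans (cong (λ w → lookup w i) e) (lookup-bump v i))))

up-injective : {u v : Word n} → up u ≡ up v → u ≡ v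
up-injective = bump-injective ∘ VecP.∷-injectiveʳ ∘ VecP.∷-injectiveʳ

isPerm-up : {w : Word n} → T (isPerm w) → T (isPerm (up w))
isPerm-up {w = w} pw = injective⇒distinct (up w) inj
  where
  inj : Injective (up w)
  inj {zero} {zero} _ = refl
  inj {zero} {suc zero} ()
  inj {zero} {suc (suc j)} e with () ← trans e (lookup-bump w j)
  inj {suc zero} {zero} ()
  inj {suc zero} {suc zero} _ = refl
  inj {suc zero} {suc (suc j)} e with () ← trans e (lookup-bump w j)
  inj {suc (suc i)} {zero} e with () ← trans (sym (lookup-bump w i)) e
  inj {suc (suc i)} {suc zero} e with () ← trans (sym (lookup-bump w i)) e
  inj {suc (suc i)} {suc (suc j)} e = cong suc² (isPerm-injective {u = w} pw
    (suc-injective (suc-injective (trans (sym (lookup-bump w i)) (trans e (lookup-bump w j))))))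

isPerm-up⁻ : {w : Word n} → T (isPerm (up w)) → T (isPerm w)
isPerm-up⁻ {w = w} pw = injective⇒distinct w λ {i} {j} e →
  suc-injective (suc-injective (isPerm-injective {u = up w} pw {suc (suc i)} {suc (suc j)}
    (trans (lookup-bump w i) (trans (cong suc² e) (sym (lookup-bump w j))))))

s₁-up : (w : Word n) → s₁ (up w) ≡ suc zero ∷ zero ∷ bump w
s₁-up w = lookup-ext at′
  where
  at′ : ∀ i → lookup (s₁ (up w)) i ≡ lookup (suc zero ∷ zero ∷ bump w) i
  at′ zero = refl
  at′ (suc zero) = refl
  at′ (suc (suc i)) = trans (lookup-swapʷ-at zero (suc zero) (up w) {suc (suc i)} (lookup-bump w i)) (sym (lookup-bump w i))

unbump : (v : Vec (Fin (suc (suc n))) m) → (∀ i → lookup v i ≢ zero) → (∀ i → lookup v i ≢ suc zero) →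
  ∃ λ v′ → v ≡ bump v′
unbump [] _ _ = [] , refl
unbump (zero ∷ v) ≢0 _ = ⊥-elim (≢0 zero refl)
unbump (suc zero ∷ v) _ ≢1 = ⊥-elim (≢1 zero refl)
unbump (suc (suc k) ∷ v) ≢0 ≢1 with unbump v (≢0 ∘ suc) (≢1 ∘ suc)
... | v′ , refl = k ∷ v′ , refl

starts01⇒up : (u : Word (suc (suc n))) → T (isPerm u) → lookup u zero ≡ zero → lookup u (suc zero) ≡ suc zero →
              ∃ λ u′ → T (isPerm u′) × u ≡ up u′
starts01⇒up u@(_ ∷ _ ∷ v) pu refl refl
  with unbump v (λ i e → 0≢ (isPerm-injective {u = u} pu {zero} {suc (suc i)} (sym e)))
                (λ i e → 1≢ (isPerm-injective {u = u} pu {suc zero} {suc (suc i)} (sym e)))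
  where
  0≢ : ∀ {i : Fin n} → Fin.zero ≢ Fin.suc i
  0≢ ()
  1≢ : ∀ {i : Fin n} → Fin.suc Fin.zero ≢ Fin.suc (Fin.suc i)
  1≢ ()
... | v′ , refl = v′ , isPerm-up⁻ {w = v′} pu , refl

data FixesView (u : Word (suc (suc n))) : Set where
  is-up   : (u′ : Word n) → T (isPerm u′) → u ≡ up u′ → FixesView u
  is-s₁up : (u′ : Word n) → T (isPerm u′) → u ≡ s₁ (up u′) → FixesView u

fixesView : (u : Word (suc (suc n))) → T (isPerm u) → Fixes zero (suc zero) u → FixesView u
fixesView u pu (inj₁ (e₀ , e₁)) with starts01⇒up u pu e₀ e₁
... | u′ , pu′ , e = is-up u′ pu′ e
fixesView u pu (inj₂ (e₀ , e₁)) with starts01⇒up (s₁ u) (isPerm-s₁ {u = u} pu)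
  (lookup-swapʷ-at zero (suc zero) u {zero} e₀) (lookup-swapʷ-at zero (suc zero) u {suc zero} e₁)
... | u′ , pu′ , e = is-s₁up u′ pu′ (trans (sym (s₁-involutive u)) (cong s₁ e))

up-∘ₚ : (u v : Word n) → up u ∘ₚ up v ≡ up (u ∘ₚ v)
up-∘ₚ u v = lookup-ext at′
  where
  at′ : ∀ i → lookup (up u ∘ₚ up v) i ≡ lookup (up (u ∘ₚ v)) i
  at′ zero = refl
  at′ (suc zero) = refl
  at′ i@(suc (suc j)) = begin
    lookup (up u ∘ₚ up v) i           ≡⟨ lookup-∘ₚ (up u) (up v) i ⟩
    lookup (up u) (lookup (bump v) j) ≡⟨ cong (lookup (up u)) (lookup-bump v j) ⟩
    lookup (bump u) (lookup v j)      ≡⟨ lookup-bump u (lookup v j) ⟩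
    suc (suc (lookup u (lookup v j))) ≡⟨ cong suc² (lookup-∘ₚ u v j) ⟨
    suc (suc (lookup (u ∘ₚ v) j))     ≡⟨ lookup-bump (u ∘ₚ v) j ⟨
    lookup (bump (u ∘ₚ v)) j          ∎
    where open ≡-Reasoning

-- `up u` is injective and fixes 1 and 2, so v must send them where `up w` does, to themselves.
∘ₚ≡up⇒up : (u w : Word n) (v : Word (suc (suc n))) → T (isPerm u) → T (isPerm v) →
  up u ∘ₚ v ≡ up w → ∃ λ v′ → T (isPerm v′) × v ≡ up v′
∘ₚ≡up⇒up u w v pu pv e = starts01⇒up v pv
  (inj (trans (sym (lookup-∘ₚ (up u) v zero)) (cong (λ w → lookup w zero) e)))
  (inj (trans (sym (lookup-∘ₚ (up u) v (suc zero))) (cong (λ w → lookup w (suc zero)) e)))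
  where
  inj : Injective (up u)
  inj = isPerm-injective {u = up u} (isPerm-up {w = u} pu)

-- The map φ and its multiplicativity.

Δ : QS (suc (suc n)) → QS (suc (suc n))
Δ x u = x u - x (s₁ u)

φ : QS (suc (suc n)) → QS n
φ x w = Δ x (up w)

restrict : {P : Set} → Dec P → ℚ → ℚ
restrict P? q = if ⌊ P? ⌋ then q else 0ℚ

restrict-minus : {P : Set} (P? : Dec P) (p q : ℚ) → restrict P? p - restrict P? q ≡ restrict P? (p - q)
restrict-minus (yes _) p q = refl
restrict-minus (no _) p q = refl

restrict-plus : {P : Set} (P? : Dec P) (p q : ℚ) → restrict P? p + restrict P? q ≡ restrict P? (p + q)
restrict-plus (yes _) p q = refl
restrict-plus (no _) p q = refl

restrict-zero : {P : Set} (P? : Dec P) {q : ℚ} → q ≡ 0ℚ → restrict P? q ≡ 0ℚ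
restrict-zero (yes _) e = e
restrict-zero (no _) _ = refl

*-distribʳ-minus : (p q r : ℚ) → p * r - q * r ≡ (p - q) * r
*-distribʳ-minus = solve 3 (λ p q r → p :* r :- q :* r := (p :- q) :* r) refl
  where open +-*-Solver

*-Δ : (p q r t : ℚ) → (p - q) * r + (q - p) * t ≡ (p - q) * (r - t)
*-Δ = solve 4 (λ p q r t → (p :- q) :* r :+ (q :- p) :* t := (p :- q) :* (r :- t)) refl
  where open +-*-Solver

-- Only the u with s₁ u = u s₁ contribute to Δ (x y), namely u = up u′ and u = s₁ (up u′).
φ-multiplicative : (x y : QS (suc (suc n))) → BaseInvariantOffFixes x → (w : Word n) → φ (x *ₐ y) w ≡ (φ x *ₐ φ y) w
φ-multiplicative {n} x y x-inv w = begin
  (x *ₐ y) (up w) - (x *ₐ y) (s₁ (up w))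
    ≡⟨ cong (λ q → (x *ₐ y) (up w) - q) reindexed ⟩
  sumL S (λ u → sumL S (F u)) - sumL S (λ u → sumL S (F′ u))
    ≡⟨ sumL-minus S (λ u → sumL S (F u)) (λ u → sumL S (F′ u)) ⟨
  sumL S (λ u → sumL S (F u) - sumL S (F′ u))
    ≡⟨ sumL-cong S (λ {u} _ → trans (sym (sumL-minus S (F u) (F′ u))) (sumL-cong S λ {v} _ →
         trans (restrict-minus (u ∘ₚ v ≟ʷ up w) (x u * y v) (x (s₁ u) * y v))
           (cong (term u v) (*-distribʳ-minus (x u) (x (s₁ u)) (y v))))) ⟩
  sumL S H
    ≡⟨ sumL-bijection _≟ʷ_ _≟ʷ_ (perms-unique _) images-unique H H id id fwd bwd ⟩
  sumL (map up S′ ++ map (s₁ ∘ up) S′) H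
    ≡⟨ sumL-++ (map up S′) _ H ⟩
  sumL (map up S′) H + sumL (map (s₁ ∘ up) S′) H
    ≡⟨ cong₂ _+_ (sumL-map up S′ H) (sumL-map (s₁ ∘ up) S′ H) ⟩
  sumL S′ (H ∘ up) + sumL S′ (H ∘ s₁ ∘ up)
    ≡⟨ sumL-+ S′ (H ∘ up) (H ∘ s₁ ∘ up) ⟨
  sumL S′ (λ u′ → H (up u′) + H (s₁ (up u′)))
    ≡⟨ sumL-cong S′ (λ {u′} u′∈ → inner u′ (∈-perms⁻ u′∈)) ⟩
  (φ x *ₐ φ y) w ∎
  where
  open ≡-Reasoning
  S = perms (suc (suc n))
  S′ = perms n
  term : Word (suc (suc n)) → Word (suc (suc n)) → ℚ → ℚ
  term u v = restrict (u ∘ₚ v ≟ʷ up w)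
  F F′ : Word (suc (suc n)) → Word (suc (suc n)) → ℚ
  F u v = term u v (x u * y v)
  F′ u v = term u v (x (s₁ u) * y v)
  H : Word (suc (suc n)) → ℚ
  H u = sumL S λ v → term u v (Δ x u * y v)
  -- Replacing u by s₁ u lets both values of the product be summed over the same factorisations of
  -- 12w.
  reindexed : (x *ₐ y) (s₁ (up w)) ≡ sumL S (λ u → sumL S (F′ u))
  reindexed = trans (sym (sumL-swapʷ zero (suc zero) (λ u → sumL S λ v → restrict (u ∘ₚ v ≟ʷ s₁ (up w)) (x u * y v))))
    (sumL-cong S λ {u} _ → sumL-cong S λ {v} _ →
    if-⇔ (s₁ u ∘ₚ v ≟ʷ s₁ (up w)) (u ∘ₚ v ≟ʷ up w)
      (λ e → swapʷ-cancel zero (suc zero) {u ∘ₚ v} {up w} (trans (sym (∘ₚ-assoc (swapʷ zero (suc zero)) u v)) e))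
      (λ e → trans (∘ₚ-assoc (swapʷ zero (suc zero)) u v) (cong s₁ e)) (λ _ → refl))
  images-unique = UniqueP.++⁺ (UniqueP.map⁺ up-injective (perms-unique n))
    (UniqueP.map⁺ (λ {u} {v} e → up-injective (swapʷ-cancel zero (suc zero) {up u} {up v} e)) (perms-unique n)) disjoint
    where
    disjoint : ∀ {u} → u ∈ map up S′ × u ∈ map (s₁ ∘ up) S′ → ⊥
    disjoint (p , q) with ∈-map⁻ up p | ∈-map⁻ (s₁ ∘ up) q
    ... | _ , _ , refl | _ , _ , ()
  fwd : ∀ {u} → u ∈ S → H u ≡ 0ℚ ⊎ (u ∈ map up S′ ++ map (s₁ ∘ up) S′ × u ≡ u × H u ≡ H u)
  fwd {u} u∈ with Fixes? zero (suc zero) u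
  ... | no ¬fix = inj₁ (trans (sumL-cong S λ {v} _ → restrict-zero (u ∘ₚ v ≟ʷ up w)
    (trans (cong (_* y v) Δ≡0) (ℚP.*-zeroˡ (y v)))) (sumL-zero S))
    where
    Δ≡0 : Δ x u ≡ 0ℚ
    Δ≡0 = trans (cong (λ q → x u - q) (x-inv refl refl {u} (∈-perms⁻ u∈) ¬fix)) (ℚP.+-inverseʳ (x u))
  ... | yes fix with fixesView u (∈-perms⁻ u∈) fix
  ...   | is-up u′ pu′ refl = inj₂ (∈-++⁺ˡ (∈-map⁺ up (∈-perms⁺ pu′)) , refl , refl)
  ...   | is-s₁up u′ pu′ refl = inj₂ (∈-++⁺ʳ (map up S′) (∈-map⁺ (s₁ ∘ up) {x = u′} (∈-perms⁺ pu′)) , refl , refl)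
  bwd : ∀ {u} → u ∈ map up S′ ++ map (s₁ ∘ up) S′ → H u ≡ 0ℚ ⊎ (u ∈ S × u ≡ u × H u ≡ H u)
  bwd u∈ with ∈-++⁻ (map up S′) u∈
  ... | inj₁ u∈′ with ∈-map⁻ up u∈′
  ...   | u′ , u′∈ , refl = inj₂ (∈-perms⁺ (isPerm-up {w = u′} (∈-perms⁻ u′∈)) , refl , refl)
  bwd u∈ | inj₂ u∈′ with ∈-map⁻ (s₁ ∘ up) u∈′
  ...   | u′ , u′∈ , refl = inj₂ (∈-perms⁺ (isPerm-s₁ {u = up u′} (isPerm-up {w = u′} (∈-perms⁻ u′∈))) , refl , refl)
  inner : ∀ u′ → T (isPerm u′) → H (up u′) + H (s₁ (up u′)) ≡
          sumL S′ (λ v′ → restrict (u′ ∘ₚ v′ ≟ʷ w) (φ x u′ * φ y v′))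
  inner u′ pu′ = begin
    H (up u′) + H (s₁ (up u′))
      -- `up u′` commutes with s₁, so replacing v by s₁ v turns the condition for `s₁ (up u′)` into
      -- the one for `up u′`.
      ≡⟨ cong (H (up u′) +_) (trans (sym (sumL-swapʷ zero (suc zero) (λ v → term (s₁ (up u′)) v (Δ x (s₁ (up u′)) * y v))))
         (sumL-cong S λ {v} _ →
           if-⇔ (s₁ (up u′) ∘ₚ s₁ v ≟ʷ up w) (up u′ ∘ₚ v ≟ʷ up w)
             (trans (slide v)) (trans (sym (slide v))) (λ _ → refl))) ⟩
    H (up u′) + sumL S (λ v → term (up u′) v (Δ x (s₁ (up u′)) * y (s₁ v)))
      ≡⟨ sumL-+ S (λ v → term (up u′) v (Δ x (up u′) * y v))
         (λ v → term (up u′) v (Δ x (s₁ (up u′)) * y (s₁ v))) ⟨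
    sumL S (λ v → term (up u′) v (Δ x (up u′) * y v) + term (up u′) v (Δ x (s₁ (up u′)) * y (s₁ v)))
      ≡⟨ sumL-cong S (λ {v} _ → trans (restrict-plus (up u′ ∘ₚ v ≟ʷ up w) (Δ x (up u′) * y v) (Δ x (s₁ (up u′)) * y (s₁ v)))
         (cong (term (up u′) v) (combine v))) ⟩
    sumL S K
      -- A factor v with `up u′ ∘ₚ v ≡ up w` must itself begin with 12, by `∘ₚ≡up⇒up`.
      ≡⟨ sumL-bijection _≟ʷ_ _≟ʷ_ (perms-unique _) (UniqueP.map⁺ up-injective (perms-unique n)) K K id id fwd′ bwd′ ⟩
    sumL (map up S′) K
      ≡⟨ sumL-map up S′ K ⟩
    sumL S′ (K ∘ up)
      ≡⟨ sumL-cong S′ (λ {v′} _ → if-⇔ (up u′ ∘ₚ up v′ ≟ʷ up w) (u′ ∘ₚ v′ ≟ʷ w)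
           (λ e → up-injective (trans (sym (up-∘ₚ u′ v′)) e)) (λ e → trans (up-∘ₚ u′ v′) (cong up e)) (λ _ → refl)) ⟩
    sumL S′ (λ v′ → restrict (u′ ∘ₚ v′ ≟ʷ w) (φ x u′ * φ y v′)) ∎
    where
    K : Word (suc (suc n)) → ℚ
    K v = term (up u′) v (φ x u′ * Δ y v)
    slide : ∀ v → up u′ ∘ₚ v ≡ s₁ (up u′) ∘ₚ s₁ v
    slide v = begin
      up u′ ∘ₚ v                                    ≡⟨ cong (up u′ ∘ₚ_) (s₁-involutive v) ⟨
      up u′ ∘ₚ s₁ (s₁ v)                            ≡⟨ ∘ₚ-assoc (up u′) (swapʷ zero (suc zero)) (s₁ v) ⟨
      (up u′ ∘ₚ swapʷ zero (suc zero)) ∘ₚ s₁ v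
        ≡⟨ cong (_∘ₚ s₁ v) (swapʷ-slide zero (suc zero) zero (suc zero) {up u′}
           (isPerm-up {w = u′} pu′) (inj₁ (refl , refl))) ⟨
      s₁ (up u′) ∘ₚ s₁ v                            ∎
    combine : ∀ v → Δ x (up u′) * y v + Δ x (s₁ (up u′)) * y (s₁ v) ≡ φ x u′ * Δ y v
    -- Since s₁ is an involution, `Δ x` changes sign under it; the two terms thus combine into a
    -- difference of values of `y`.
    combine v = trans (cong (λ q → Δ x (up u′) * y v + (x (s₁ (up u′)) - q) * y (s₁ v)) (cong x (s₁-involutive (up u′))))
      (*-Δ (x (up u′)) (x (s₁ (up u′))) (y v) (y (s₁ v)))
    fwd′ : ∀ {v} → v ∈ S → K v ≡ 0ℚ ⊎ (v ∈ map up S′ × v ≡ v × K v ≡ K v)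
    fwd′ {v} v∈ with up u′ ∘ₚ v ≟ʷ up w
    ... | no _ = inj₁ refl
    ... | yes e with ∘ₚ≡up⇒up u′ w v pu′ (∈-perms⁻ v∈) e
    ...   | v′ , pv′ , refl = inj₂ (∈-map⁺ up (∈-perms⁺ pv′) , refl , refl)
    bwd′ : ∀ {v} → v ∈ map up S′ → K v ≡ 0ℚ ⊎ (v ∈ S × v ≡ v × K v ≡ K v)
    bwd′ v∈ with ∈-map⁻ up v∈
    ... | v′ , v′∈ , refl = inj₂ (∈-perms⁺ (isPerm-up {w = v′} (∈-perms⁻ v′∈)) , refl , refl)

-- Peak sets of 12w and 21w.

-- The letter b is below every raised letter, so before w it takes the place of w₀ = 0.
isPeakAt-bump : (a b : Fin (suc (suc n))) → (∀ k → (b <ᶠ suc (suc k)) ≡ true) →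
                (w : Word n) → ∀ {p} → p ∈ range1 n →
                isPeakAt (a ∷ b ∷ bump w) (2 ℕ.+ p) ≡ isPeakAt w p
isPeakAt-bump {n} a b b< w p∈ with ∈-range1⁻ {n} p∈
... | i , j , i→j , refl with predecessor i
...   | inj₁ i≡0 = begin
  isPeakAt w′ (ℕ.suc (2 ℕ.+ toℕ i))
    ≡⟨ isPeakAt-interior w′ {suc zero} {suc (suc i)} {suc (suc j)} (cong (2 ℕ.+_) i≡0) (cong (2 ℕ.+_) i→j) ⟩
  summit b (lookup (bump w) i) (lookup (bump w) j)      ≡⟨ cong₂ (summit b) (lookup-bump w i) (lookup-bump w j) ⟩
  summit b (suc (suc (lookup w i))) (suc (suc (lookup w j))) ≡⟨ cong (_∧ (lookup w j <ᶠ lookup w i)) (b< (lookup w i)) ⟩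
  (lookup w j <ᶠ lookup w i)                            ≡⟨ isPeakAt-first w {i} {j} i≡0 i→j ⟨
  isPeakAt w (ℕ.suc (toℕ i))                            ∎
  where
  open ≡-Reasoning
  w′ = a ∷ b ∷ bump w
...   | inj₂ (h , h→i) = begin
  isPeakAt w′ (ℕ.suc (2 ℕ.+ toℕ i))
    ≡⟨ isPeakAt-interior w′ {suc (suc h)} {suc (suc i)} {suc (suc j)} (cong (2 ℕ.+_) h→i) (cong (2 ℕ.+_) i→j) ⟩
  summit (lookup (bump w) h) (lookup (bump w) i) (lookup (bump w) j)
    ≡⟨ cong (λ k → summit k (lookup (bump w) i) (lookup (bump w) j)) (lookup-bump w h) ⟩
  summit (suc (suc (lookup w h))) (lookup (bump w) i) (lookup (bump w) j)
    ≡⟨ cong₂ (summit (suc (suc (lookup w h)))) (lookup-bump w i) (lookup-bump w j) ⟩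
  summit (lookup w h) (lookup w i) (lookup w j)         ≡⟨ isPeakAt-interior w {h} {i} {j} h→i i→j ⟨
  isPeakAt w (ℕ.suc (toℕ i))                            ∎
  where
  open ≡-Reasoning
  w′ = a ∷ b ∷ bump w

filterB-bump : (a b : Fin (suc (suc n))) → (∀ k → (b <ᶠ suc (suc k)) ≡ true) → (w : Word n) →
               filterB (isPeakAt (a ∷ b ∷ bump w)) (map (2 ℕ.+_) (range1 n)) ≡ map (2 ℕ.+_) (Peak w)
filterB-bump {n} a b b< w = trans (filterB-map (isPeakAt (a ∷ b ∷ bump w)) (2 ℕ.+_) (range1 n))
  (cong (map (2 ℕ.+_)) (filterB-cong (range1 n) (isPeakAt-bump a b b< w)))

range1-bump : ∀ n → range1 (3 ℕ.+ n) ≡ 1 ∷ 2 ∷ map (2 ℕ.+_) (range1 (ℕ.suc n))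
range1-bump n = cong (λ L → 1 ∷ 2 ∷ L) (begin
  map ℕ.suc (applyUpTo (2 ℕ.+_) n)          ≡⟨ ListP.map-applyUpTo (2 ℕ.+_) ℕ.suc n ⟩
  applyUpTo (3 ℕ.+_) n                      ≡⟨ ListP.map-applyUpTo ℕ.suc (2 ℕ.+_) n ⟨
  map (2 ℕ.+_) (applyUpTo ℕ.suc n)          ≡⟨ cong (map (2 ℕ.+_)) (ListP.map-applyUpTo id ℕ.suc n) ⟨
  map (2 ℕ.+_) (map ℕ.suc (applyUpTo id n)) ∎)
  where open ≡-Reasoning

Peak-up : (w : Word n) → Peak (up w) ≡ map (2 ℕ.+_) (Peak w)
Peak-up [] = refl
-- Position 2 is in range only for nonempty w, whence the separate empty case. With the next letter
-- exposed by the pattern, positions 1 and 2 are decided by computation.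
Peak-up {ℕ.suc n} w@(_ ∷ _) = trans (cong (filterB (isPeakAt (up w))) (range1-bump n))
  (filterB-bump zero (suc zero) (λ _ → refl) w)

Peak-s₁up : (w : Word n) → Peak (s₁ (up w)) ≡ 1 ∷ map (2 ℕ.+_) (Peak w)
Peak-s₁up [] = refl
Peak-s₁up {ℕ.suc n} w@(_ ∷ _) = trans (cong Peak (s₁-up w))
  (trans (cong (filterB (isPeakAt (suc zero ∷ zero ∷ bump w))) (range1-bump n))
    (cong (1 ∷_) (filterB-bump (suc zero) zero (λ _ → refl) w)))

φ-factors : {x : QS (suc (suc n))} {c : List ℕ → ℚ} → (∀ {u} → T (isPerm u) → x u ≡ c (Peak u)) →
  ∀ {w} → T (isPerm w) → φ x w ≡ c (map (2 ℕ.+_) (Peak w)) - c (1 ∷ map (2 ℕ.+_) (Peak w))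
φ-factors {c = c} x≡ {w} pw = cong₂ _-_
  (trans (x≡ (isPerm-up {w = w} pw)) (cong c (Peak-up w)))
  (trans (x≡ (isPerm-s₁ {u = up w} (isPerm-up {w = w} pw))) (cong c (Peak-s₁up w)))

-- Kernel and surjectivity of φ.

minus-cong₀ : {p q : ℚ} → p - q ≡ 0ℚ → p ≡ q
minus-cong₀ {p} {q} e = begin
  p           ≡⟨ solve 2 (λ p q → p := (p :- q) :+ q) refl p q ⟩
  (p - q) + q ≡⟨ cong (_+ q) e ⟩
  0ℚ + q      ≡⟨ ℚP.+-identityˡ q ⟩
  q           ∎
  where
  open ≡-Reasoning
  open +-*-Solver

-- A word preserving {1, 2} is 12w or 21w, and there the required equality is the vanishing of φ at
-- w. The other words are covered by `BaseInvariantOffFixes`.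
φ≈0⇒baseInvariant : {x : QS (suc (suc n))} → BaseInvariantOffFixes x → φ x ≈ 0ₐ → BaseInvariant x
φ≈0⇒baseInvariant {x = x} x-inv φ≈0 {a} {b} a≡0 b≡1 {u} pu
  with toℕ-injective {i = a} {zero} a≡0 | toℕ-injective {i = b} {suc zero} b≡1
... | refl | refl with Fixes? zero (suc zero) u
...   | no ¬fix = x-inv refl refl {u} pu ¬fix
...   | yes fix with fixesView u pu fix
...     | is-up u′ pu′ refl = sym (minus-cong₀ (φ≈0 u′ pu′))
...     | is-s₁up u′ pu′ refl = trans (cong x (s₁-involutive (up u′))) (minus-cong₀ (φ≈0 u′ pu′))

baseInvariant⇒φ≈0 : {x : QS (suc (suc n))} → BaseInvariant x → φ x ≈ 0ₐ
baseInvariant⇒φ≈0 {x = x} x-inv w pw =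
  trans (cong (λ q → x (up w) - q) (x-inv refl refl {up w} (isPerm-up {w = w} pw))) (ℚP.+-inverseʳ (x (up w)))

-- Coefficients of a preimage under `φ`: words 21w get 0, so the difference is the value at 12w, and
-- subtracting 2 undoes the shift by the prefix. Peak sets are increasing lists, so 1 can only be
-- their head.
shiftDown : (List ℕ → ℚ) → List ℕ → ℚ
shiftDown c (1 ∷ _) = 0ℚ
shiftDown c F = c (map (_∸ 2) F)

shiftDown-bump : (c : List ℕ → ℚ) (F : List ℕ) → shiftDown c (map (2 ℕ.+_) F) ≡ c F
shiftDown-bump c [] = refl
shiftDown-bump c (p ∷ F) = cong (λ G → c (p ∷ G)) (trans (sym (ListP.map-∘ F)) (ListP.map-id F))

quotientIso : ∀ m → QuotientIso m
quotientIso m = record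
  { φ = φ
  -- The two terms are the values of c at the peak sets of 12w and 21w when w has peak set `F`.
  ; maps-to = λ x x∈ → let c , x≡ = In𝔓⁻ x∈ in
      In𝔓⁺ ((λ F → c (map (2 ℕ.+_) F) - c (1 ∷ map (2 ℕ.+_) F)) , λ {w} pw → φ-factors {x = x} {c} x≡ {w} pw)
  ; respects = λ x y _ _ x≈y w pw → cong₂ _-_ (x≈y (up w) (isPerm-up {w = w} pw))
      (x≈y (s₁ (up w)) (isPerm-s₁ {u = up w} (isPerm-up {w = w} pw)))
  ; additive = λ x y _ _ w _ → solve 4 (λ p q r t → (p :+ q) :- (r :+ t) := (p :- r) :+ (q :- t)) refl
      (x (up w)) (y (up w)) (x (s₁ (up w))) (y (s₁ (up w)))
  ; homog = λ c x _ w _ → solve 3 (λ c p q → c :* p :- c :* q := c :* (p :- q)) refl c (x (up w)) (x (s₁ (up w)))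
  ; multiplicative = λ x y x∈ _ w _ → φ-multiplicative x y (𝔓-baseInvariantOffFixes x∈) w
  ; kernel = λ x x∈ →
      (λ φ≈0 → invariant⇒𝔓̊ (𝔓-adjInvariant x∈) (φ≈0⇒baseInvariant (𝔓-baseInvariantOffFixes x∈) φ≈0)) ,
      (λ x∈̊ → baseInvariant⇒φ≈0 (𝔓̊-baseInvariant x∈̊))
  ; onto = λ y y∈ → let c , y≡ = In𝔓⁻ y∈ in
      shiftDown c ∘ Peak , In𝔓⁺ (shiftDown c , λ _ → refl) , λ w pw →
        trans (φ-factors {x = shiftDown c ∘ Peak} {shiftDown c} (λ _ → refl) {w} pw)
          (trans (ℚP.+-identityʳ _) (trans (shiftDown-bump c (Peak w)) (sym (y≡ pw))))
  }
  where open +-*-Solver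

theorem5p7 : ((n : ℕ) → IsTwoSidedIdealOf𝔓 (suc n)) × ((m : ℕ) → QuotientIso m)
theorem5p7 = (λ n → 𝔓̊-ideal (suc n)) , quotientIso
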